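{- The following hold. (1) $\mathsf{\#P}^{\mathsf{\#P}} = \mathsf{\#P}^{\mathsf{\#P}[1]}$. (2) $\mathsf{GapP}^{\mathsf{\#P}} = \mathsf{GapP}^{\mathsf{\#P}[1]}$.
   Context: NPTM means nondeterministic polynomial-time bounded Turing machine. For an NPTM $M$ (possibly with an oracle) and $x \in \Sigma^*$, $acc_M(x)$ and $rej_M(x)$ are the numbers of accepting and rejecting computation paths of $M$ on $x$, and $gap_M(x) = acc_M(x) - rej_M(x)$. $\mathsf{\#P}$ and $\mathsf{GapP}$ are the classes of functions $acc_M$ and $gap_M$, respectively, with $M$ an NPTM. $\mathsf{\#P}^{\mathsf{\#P}}$ (respectively $\mathsf{GapP}^{\mathsf{\#P}}$) is the class of functions $acc_{M^f}$ (respectively $gap_{M^f}$) with $M^f$ an NPTM having a function oracle $f \in \mathsf{\#P}$ (a query $y$ is answered by the value $f(y)$ in binary). The suffix $[1]$ means that the oracle machine makes at most one query to the oracle on every computation path. -}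

module Defs where

open import Data.Bool.Base using (Bool; true; false; if_then_else_; not)
open import Data.Fin.Base using (Fin; zero; suc)
open import Data.Integer.Base using (ℤ; _⊖_)
open import Data.List.Base using (List; []; _∷_; [_]; length; map; concatMap; filterᵇ; null; reverse)
open import Data.List.Relation.Unary.All using (All)
open import Data.Maybe.Base using (Maybe; just; nothing; is-just)
open import Data.Nat.Base using (ℕ; zero; suc; _+_; _*_; _^_; _≤_)
open import Data.Product.Base using (_×_; _,_; ∃-syntax; Σ-syntax; proj₁)
open import Data.Vec.Base as Vec using (Vec; _∷_; lookup; _[_]≔_; zipWith; replicate)
open import Function.Base using (_∘_)
open import Function.Bundles using (_↔_)
open import Level using (0ℓ) renaming (suc to lsuc)
open import Relation.Binary.PropositionalEquality using (_≡_)
open import Relation.Unary using (Pred)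

Finite : Set → Set
Finite A = ∃[ n ] (A ↔ Fin n)

-- Σ = {0,1}, with 0 = false and 1 = true.

Word : Set
Word = List Bool

-- Binary numerals.  The increment acts on least-significant-first digits;
-- `binary` is most significant digit first, without leading zeros, and
-- binary 0 = 0.

increment : List Bool → List Bool
increment []           = [ true ]
increment (false ∷ bs) = true ∷ bs
increment (true  ∷ bs) = false ∷ increment bs

binaryLSB : ℕ → List Bool
binaryLSB zero    = [ false ]
binaryLSB (suc n) = increment (binaryLSB n)

binary : ℕ → Word
binary = reverse ∘ binaryLSB

------------------------------------------------------------------------
-- Tapes

data Symbol (A : Set) : Set where
  blank : Symbol A
  bit   : Bool → Symbol A
  aux   : A → Symbol A

-- A two-way infinite tape: the cells left of the head (nearest first), the
-- scanned cell, and the cells right of the head (nearest first).  All cells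
-- not listed are blank.

record Tape (A : Set) : Set where
  constructor tape
  field
    left  : List (Symbol A)
    head  : Symbol A
    right : List (Symbol A)

data Move : Set where
  moveLeft stay moveRight : Move

module _ {A : Set} where

  emptyTape : Tape A
  emptyTape = tape [] blank []

  move : Move → Tape A → Tape A
  move stay      t                  = t
  move moveLeft  (tape []      h r) = tape [] blank (h ∷ r)
  move moveLeft  (tape (s ∷ l) h r) = tape l s (h ∷ r)
  move moveRight (tape l h [])      = tape (h ∷ l) blank []
  move moveRight (tape l h (s ∷ r)) = tape (h ∷ l) s r

  act : Symbol A × Move → Tape A → Tape A
  act (s , m) t = move m (record t { head = s })

  writeWord : Word → Tape A
  writeWord []       = emptyTape
  writeWord (b ∷ bs) = tape [] (bit b) (map bit bs)

  bitPrefix : List (Symbol A) → Word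
  bitPrefix (bit b ∷ ss) = b ∷ bitPrefix ss
  bitPrefix _            = []

  -- The word starting at the scanned cell and ending before the first cell to
  -- its right that does not hold a bit.

  readWord : Tape A → Word
  readWord (tape _ h r) = bitPrefix (h ∷ r)

------------------------------------------------------------------------
-- Nondeterministic machines

-- A nondeterministic Turing machine with an input tape and k further tapes.
-- δ lists the transitions available to choose from; distinct entries are
-- distinct choices.  The machine halts when the list is empty, and then
-- accepts if its state is accepting and rejects otherwise.

record Machine (k : ℕ) : Set₁ where
  field
    State         : Set
    Aux           : Set
    finite-State  : Finite State
    finite-Aux    : Finite Aux
    start         : State
    accepting     : State → Bool
    δ             : State → Vec (Symbol Aux) (suc k) →
                    List (State × Vec (Symbol Aux × Move) (suc k))

  Config : Set
  Config = State × Vec (Tape Aux) (suc k)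

  initial : Word → Config
  initial x = start , writeWord x ∷ replicate k emptyTape

  step : Config → List Config
  step (s , ts) =
    map (λ (s′ , as) → s′ , zipWith act as ts) (δ s (Vec.map Tape.head ts))

-- The first two tapes besides the input tape are the query tape and the
-- answer tape.  A state q with `resume q ≡ just q′` is a query state: its
-- only transition is the oracle call, which leads to q′.

record OracleMachine : Set₁ where
  field
    extraTapes : ℕ
    machine    : Machine (2 + extraTapes)

  open Machine machine public

  field
    resume : State → Maybe State

  queryTape answerTape : Fin (3 + extraTapes)
  queryTape  = suc zero
  answerTape = suc (suc zero)

  -- One step with oracle f.  An oracle call replaces the whole contents of the
  -- answer tape, with the head on the first digit, and changes no other tape.

  oracleStep : (Word → ℕ) → Config → List Config
  oracleStep f (s , ts) with resume s
  ... | nothing = step (s , ts)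
  ... | just s′ =
    [ s′ , ts [ answerTape ]≔ writeWord (binary (f (readWord (lookup ts queryTape)))) ]

------------------------------------------------------------------------
-- Computation paths

record System : Set₁ where
  field
    Config    : Set
    initial   : Word → Config
    step      : Config → List Config
    accepting : Config → Bool
    querying  : Config → Bool

plain : ∀ {k} → Machine k → System
plain M = record
  { Config    = Config
  ; initial   = initial
  ; step      = step
  ; accepting = accepting ∘ proj₁
  ; querying  = λ _ → false
  }
  where open Machine M

_withOracle_ : OracleMachine → (Word → ℕ) → System
M withOracle f = record
  { Config    = Config
  ; initial   = initial
  ; step      = oracleStep f
  ; accepting = accepting ∘ proj₁
  ; querying  = is-just ∘ resume ∘ proj₁
  }
  where open OracleMachine M

module _ (S : System) where
  open System S

  data Path : Set where
    end  : Config → Path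
    _⟶_ : Config → Path → Path

  -- The paths from c that halt within t steps.

  paths : ℕ → Config → List Path
  paths zero    c = if null (step c) then [ end c ] else []
  paths (suc t) c = if null (step c) then [ end c ]
                    else map (c ⟶_) (concatMap (paths t) (step c))

  HaltsWithin : ℕ → Config → Set
  HaltsWithin zero    c = step c ≡ []
  HaltsWithin (suc t) c = All (HaltsWithin t) (step c)

  accepts : Path → Bool
  accepts (end c)  = accepting c
  accepts (_ ⟶ π) = accepts π

  queries : Path → ℕ
  queries (end c)  = if querying c then 1 else 0
  queries (c ⟶ π) = (if querying c then 1 else 0) + queries π

-- Polynomial time: every path on every input x has length at most
-- coefficient · |x|^degree + coefficient.

record PolynomialTime (S : System) : Set where
  open System S
  field
    coefficient degree : ℕ

  bound : ℕ → ℕ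
  bound n = coefficient * n ^ degree + coefficient

  field
    halts : ∀ x → HaltsWithin S (bound (length x)) (initial x)

  computationPaths : Word → List (Path S)
  computationPaths x = paths S (bound (length x)) (initial x)

  acc rej : Word → ℕ
  acc x = length (filterᵇ (accepts S) (computationPaths x))
  rej x = length (filterᵇ (not ∘ accepts S) (computationPaths x))

  gap : Word → ℤ
  gap x = acc x ⊖ rej x

  AtMostOneQuery : Set
  AtMostOneQuery = ∀ x → All (λ π → queries S π ≤ 1) (computationPaths x)

open PolynomialTime using (acc; gap; AtMostOneQuery)

------------------------------------------------------------------------
-- Function classes

#P : Pred (Word → ℕ) (lsuc 0ℓ)
#P g = ∃[ k ] Σ[ M ∈ Machine k ] Σ[ T ∈ PolynomialTime (plain M) ]
  (∀ x → g x ≡ acc T x)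

#P^#P : Pred (Word → ℕ) (lsuc 0ℓ)
#P^#P g = ∃[ f ] #P f × (Σ[ M ∈ OracleMachine ]
  Σ[ T ∈ PolynomialTime (M withOracle f) ]
  (∀ x → g x ≡ acc T x))

#P^#P[1] : Pred (Word → ℕ) (lsuc 0ℓ)
#P^#P[1] g = ∃[ f ] #P f × (Σ[ M ∈ OracleMachine ]
  Σ[ T ∈ PolynomialTime (M withOracle f) ]
  AtMostOneQuery T × (∀ x → g x ≡ acc T x))

GapP^#P : Pred (Word → ℤ) (lsuc 0ℓ)
GapP^#P g = ∃[ f ] #P f × (Σ[ M ∈ OracleMachine ]
  Σ[ T ∈ PolynomialTime (M withOracle f) ]
  (∀ x → g x ≡ gap T x))

GapP^#P[1] : Pred (Word → ℤ) (lsuc 0ℓ)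
GapP^#P[1] g = ∃[ f ] #P f × (Σ[ M ∈ OracleMachine ]
  Σ[ T ∈ PolynomialTime (M withOracle f) ]
  AtMostOneQuery T × (∀ x → g x ≡ gap T x))

{-# OPTIONS --safe #-}

-- To replace many queries to f by one, the new machine guesses the answers
-- a₁, …, aₘ of the oracle while simulating M, and records the queries yᵢ and the
-- padded guesses as it goes along.  The single query at the end asks for a
-- number in #P that packs the differences f yᵢ - aᵢ into disjoint blocks of
-- binary digits, shifted so that all guesses are right if and only if every
-- digit of the answer is 1.  A path with a wrong guess is abandoned: it rejects
-- when accepting paths are counted, and splits into an accepting and a rejecting
-- path when the gap is.  As a simulation with wrong answers need not halt, and
-- as the answers have to be padded to some length, both are controlled by a
-- unary clock of polynomial length that is written down first.

module Submission where

-- Guessing removes adaptivity: once the answers are fixed, so are the later queries of the path,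
-- and all guesses can be tested together. The obstacle is that a single value of a #P function has
-- to certify every equality, while #P offers no subtraction. The complement of a guess a with m
-- digits is 2^m - 1 - a, and adding it to f y gives 2^m - 1 + (f y - a). If f y < 2^m, the
-- successor of this number is divisible by 2^m only when a = f y; with too few digits, a guess that
-- is off by a multiple of 2^m would leave no remainder. Padding must not multiply the branches,
-- however, since the value of M has to be counted exactly once. So a branch guesses a numeral
-- without leading zeros, of which each number has one, and the padding zeros go into the query word
-- only. Both classes are served by one induction on runs, which establishes halting, the number of
-- queries and a value in an arbitrary monoid at the same time.

open import Algebra.Structures using (IsMonoid)
open import Data.Bool.Base using (Bool; true; false; if_then_else_; not; _∧_)
open import Data.Bool.ListAction using (and)
open import Data.Bool.Properties using (∧-assoc; ∧-comm; ∧-identityʳ; ¬-not) renaming (_≟_ to _≟ᵇ_)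
open import Data.Fin.Base using (Fin; zero; suc; toℕ; inject₁; fromℕ)
open import Data.Fin.Patterns
open import Data.Fin.Properties using (2↔Bool; +↔⊎; *↔×; all?; _≟_; toℕ-inject₁; toℕ-fromℕ)
open import Data.Integer.Base as ℤ using (ℤ; _⊖_; 0ℤ; 1ℤ; -1ℤ)
import Data.Integer.Properties as ℤ
open import Data.List.Base
  using (List; []; _∷_; [_]; _++_; _ʳ++_; length; map; concatMap; foldr; null; filterᵇ; reverse; replicate)
open import Data.List.Properties
  using ( map-++; map-∘; length-++; length-map; length-reverse; length-replicate; length-ʳ++; map-ʳ++
        ; ++-identityʳ; ʳ++-defn; reverse-map; reverse-involutive; unfold-reverse; ∷-injectiveʳ; ≡-dec)
open import Data.List.Relation.Unary.All as All using (All; []; _∷_)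
import Data.List.Relation.Unary.All.Properties as All
open import Data.Maybe.Base using (Maybe; just; nothing)
open import Data.Nat.Base
open import Data.Nat.Divisibility using (_∣_; divides; *-cancelˡ-∣; ∣m+n∣m⇒∣n; ∣m⇒∣m*n)
open import Data.Nat.DivMod using ([m+kn]%n≡m%n; m<n⇒m%n≡m)
open import Data.Nat.Properties hiding (_≟_)
open import Data.Nat.Tactic.RingSolver using (solve-∀)
open import Data.Product.Base using (_×_; _,_; ∃-syntax; Σ-syntax; proj₁; proj₂)
open import Data.Product.Function.NonDependent.Propositional using (_×-↔_)
open import Data.Sum.Base using (_⊎_; inj₁; inj₂)
open import Data.Sum.Function.Propositional using (_⊎-↔_)
open import Data.Vec.Base as Vec using (Vec; []; _∷_; zipWith)
open import Function.Base using (_∘_)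
open import Function.Bundles using (Inverse; mk↔ₛ′)
import Function.Properties.Inverse as ↔
open import Relation.Binary.PropositionalEquality hiding ([_])
open import Relation.Nullary using (¬_; yes; no; does)
open import Relation.Nullary.Decidable using (True; toWitness; dec-true; dec-false)
open import Relation.Unary using (_≐_)
open import Defs

open Tape

-- Values of runs

-- A way of valuing halting paths; `void` lists outcomes that together are
-- worth nothing, with which a path can be abandoned.

record Counting : Set₁ where
  infixr 6 _∙_
  field
    Value         : Set
    _∙_           : Value → Value → Value
    ε             : Value
    isMonoid      : IsMonoid _≡_ _∙_ ε
    weight        : Bool → Value

  open IsMonoid isMonoid public using (identityˡ; identityʳ; assoc)

  total : List Value → Value
  total = foldr _∙_ ε

  field
    void          : List Bool
    void-nonempty : null void ≡ false
    void-total    : total (map weight void) ≡ ε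

  total-++ : ∀ xs ys → total (xs ++ ys) ≡ total xs ∙ total ys
  total-++ []       ys = sym (identityˡ _)
  total-++ (x ∷ xs) ys = trans (cong (x ∙_) (total-++ xs ys)) (sym (assoc x _ _))

  tally : (S : System) → ℕ → System.Config S → Value
  tally S t c = total (map (weight ∘ accepts S) (paths S t c))

module Runs (𝒦 : Counting) (S : System) where
  open Counting 𝒦
  open System S

  cost : Config → ℕ
  cost c = if querying c then 1 else 0

  -- Run t q c v: every path from c halts within t steps and makes at most q
  -- queries, and the weights of the paths add up to v.

  mutual
    data Run : ℕ → ℕ → Config → Value → Set where
      halt : ∀ {t q c} → step c ≡ [] → cost c ≤ q →
             Run t q c (weight (accepting c))
      go   : ∀ {t q q′ c d ds v} → step c ≡ d ∷ ds → cost c + q ≤ q′ →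
             Runs t q (d ∷ ds) v → Run (suc t) q′ c v

    data Runs : ℕ → ℕ → List Config → Value → Set where
      []  : ∀ {t q} → Runs t q [] ε
      _∷_ : ∀ {t q c cs v w} → Run t q c v → Runs t q cs w →
            Runs t q (c ∷ cs) (v ∙ w)

  mutual
    weaken : ∀ {t t′ q c v} → t ≤ t′ → Run t q c v → Run t′ q c v
    weaken t≤t′       (halt eq q≤)    = halt eq q≤
    weaken (s≤s t≤t′) (go eq q≤ runs) = go eq q≤ (weakens t≤t′ runs)

    weakens : ∀ {t t′ q cs v} → t ≤ t′ → Runs t q cs v → Runs t′ q cs v
    weakens t≤t′ []           = []
    weakens t≤t′ (run ∷ runs) = weaken t≤t′ run ∷ weakens t≤t′ runs

  mutual
    run-halts : ∀ {t q c v} → Run t q c v → HaltsWithin S t c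
    run-halts {zero}  (halt eq _) = eq
    run-halts {suc t} (halt eq _) rewrite eq = []
    run-halts (go eq _ runs) rewrite eq = runs-halt runs

    runs-halt : ∀ {t q cs v} → Runs t q cs v → All (HaltsWithin S t) cs
    runs-halt []           = []
    runs-halt (run ∷ runs) = run-halts run ∷ runs-halt runs

  mutual
    run-queries : ∀ {t q c v} → Run t q c v →
                  All (λ π → queries S π ≤ q) (paths S t c)
    run-queries {zero}  (halt eq q≤) rewrite eq = q≤ ∷ []
    run-queries {suc t} (halt eq q≤) rewrite eq = q≤ ∷ []
    run-queries {c = c} (go eq q≤ runs) rewrite eq =
      All.map⁺ (All.map (λ π≤ → ≤-trans (+-monoʳ-≤ (cost c) π≤) q≤)
                        (runs-queries runs))

    runs-queries : ∀ {t q cs v} → Runs t q cs v →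
                   All (λ π → queries S π ≤ q) (concatMap (paths S t) cs)
    runs-queries []           = []
    runs-queries (run ∷ runs) = All.++⁺ (run-queries run) (runs-queries runs)

  private
    tallies : ℕ → List Config → Value
    tallies t cs = total (map (weight ∘ accepts S) (concatMap (paths S t) cs))

    tallies-∷ : ∀ t c cs → tallies t (c ∷ cs) ≡ tally S t c ∙ tallies t cs
    tallies-∷ t c cs = trans
      (cong total (map-++ (weight ∘ accepts S) (paths S t c) (concatMap (paths S t) cs)))
      (total-++ (map (weight ∘ accepts S) (paths S t c)) _)

    tally-halt : ∀ t {c} → step c ≡ [] → tally S t c ≡ weight (accepting c)
    tally-halt zero    eq rewrite eq = identityʳ _
    tally-halt (suc t) eq rewrite eq = identityʳ _

    tally-go : ∀ t {c d ds} → step c ≡ d ∷ ds →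
               tally S (suc t) c ≡ tallies t (d ∷ ds)
    tally-go t {d = d} {ds} eq rewrite eq =
      cong total (sym (map-∘ (concatMap (paths S t) (d ∷ ds))))

  mutual
    run-tally : ∀ {t q c v} → Run t q c v → tally S t c ≡ v
    run-tally {t} (halt eq _)          = tally-halt t eq
    run-tally {suc t} (go eq _ runs)   = trans (tally-go t eq) (runs-tally runs)

    runs-tally : ∀ {t q cs v} → Runs t q cs v → tallies t cs ≡ v
    runs-tally []           = refl
    runs-tally {t} {cs = c ∷ cs} (run ∷ runs) =
      trans (tallies-∷ t c cs) (cong₂ _∙_ (run-tally run) (runs-tally runs))

  cost≤1 : ∀ c → cost c ≤ 1
  cost≤1 c with querying c
  ... | true  = ≤-refl
  ... | false = z≤n

  mutual
    -- This is how the given machine enters the argument. A path of at most `t` steps visits at most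
    -- `suc t` configurations, each of which costs at most one query.
    halts-run : ∀ t {c} → HaltsWithin S t c → Run t (suc t) c (tally S t c)
    halts-run zero {c} h =
      subst (Run 0 1 c) (sym (tally-halt 0 h)) (halt h (cost≤1 c))
    halts-run (suc t) {c} h with step c in eq
    ... | []     = subst (Run (suc t) (suc (suc t)) c) (sym (identityʳ _))
                     (halt eq (≤-trans (cost≤1 c) (s≤s z≤n)))
    ... | d ∷ ds =
      subst (Run (suc t) (suc (suc t)) c)
        (cong total (map-∘ (concatMap (paths S t) (d ∷ ds))))
        (go eq (+-monoˡ-≤ (suc t) (cost≤1 c)) (halt-runs t h))

    halt-runs : ∀ t {cs} → All (HaltsWithin S t) cs →
                Runs t (suc t) cs (tallies t cs)
    halt-runs t []       = []
    halt-runs t {c ∷ cs} (h ∷ hs) =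
      subst (Runs t (suc t) (c ∷ cs)) (sym (tallies-∷ t c cs))
        (halts-run t h ∷ halt-runs t hs)

  run₁ : ∀ {t q q′ c d v} → step c ≡ [ d ] → cost c + q ≤ q′ →
         Run t q d v → Run (suc t) q′ c v
  run₁ {c = c} eq q≤ run = subst (Run _ _ c) (identityʳ _) (go eq q≤ (run ∷ []))

  go-all : ∀ {t q q′ c v} → null (step c) ≡ false → cost c + q ≤ q′ →
           Runs t q (step c) v → Run (suc t) q′ c v
  go-all {c = c} nonempty q≤ runs with step c in eq
  ... | d ∷ ds = go eq q≤ runs

-- Polynomial bounds

-- The base is at least 2, so a larger exponent absorbs constants and sums, at `n = 0` as well. The
-- exponent will also be the number of rounds in which the clock is set.
IsPoly : (ℕ → ℕ) → Set
IsPoly h = ∃[ e ] ∀ n → h n ≤ (2 + n) ^ e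

pow-mono : ∀ n {d e} → d ≤ e → (2 + n) ^ d ≤ (2 + n) ^ e
pow-mono n = ^-monoʳ-≤ (2 + n)

m≤[2+n]^m : ∀ m n → m ≤ (2 + n) ^ m
m≤[2+n]^m zero    n = z≤n
m≤[2+n]^m (suc m) n = begin
  1 + m                           ≤⟨ +-mono-≤ (m^n>0 (2 + n) m) (m≤[2+n]^m m n) ⟩
  (2 + n) ^ m + (2 + n) ^ m       ≤⟨ +-monoʳ-≤ ((2 + n) ^ m) (m≤m+n _ (n * (2 + n) ^ m)) ⟩
  (2 + n) * (2 + n) ^ m           ∎
  where open ≤-Reasoning

poly-≤ : ∀ {h k} → (∀ n → h n ≤ k n) → IsPoly k → IsPoly h
poly-≤ h≤k (e , k≤) = e , λ n → ≤-trans (h≤k n) (k≤ n)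

poly-const : ∀ m → IsPoly (λ _ → m)
poly-const m = m , m≤[2+n]^m m

poly-id : IsPoly (λ n → n)
poly-id = 1 , λ n → ≤-trans (m≤n+m n 2) (≤-reflexive (sym (^-identityʳ (2 + n))))

poly-* : ∀ {h k} → IsPoly h → IsPoly k → IsPoly (λ n → h n * k n)
poly-* (d , h≤) (e , k≤) = d + e , λ n →
  ≤-trans (*-mono-≤ (h≤ n) (k≤ n)) (≤-reflexive (sym (^-distribˡ-+-* (2 + n) d e)))

poly-+ : ∀ {h k} → IsPoly h → IsPoly k → IsPoly (λ n → h n + k n)
poly-+ {h} {k} (d , h≤) (e , k≤) = suc (d + e) , λ n → begin
  h n + k n                             ≤⟨ +-mono-≤ (≤-trans (h≤ n) (pow-mono n (m≤m+n d e)))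
                                                    (≤-trans (k≤ n) (pow-mono n (m≤n+m e d))) ⟩
  (2 + n) ^ (d + e) + (2 + n) ^ (d + e) ≤⟨ +-monoʳ-≤ ((2 + n) ^ (d + e)) (m≤m+n _ (n * (2 + n) ^ (d + e))) ⟩
  (2 + n) ^ suc (d + e)                 ∎
  where open ≤-Reasoning

poly-^ : ∀ {h} e → IsPoly h → IsPoly (λ n → h n ^ e)
poly-^ zero    _ = poly-const 1
poly-^ (suc e) h = poly-* h (poly-^ e h)

poly-∘ : ∀ {h k} → IsPoly h → IsPoly k → IsPoly (λ n → h (k n))
poly-∘ (d , h≤) k = poly-≤ (λ n → h≤ _) (poly-^ d (poly-+ (poly-const 2) k))

*-distribʳ-^ : ∀ m n e → (m * n) ^ e ≡ m ^ e * n ^ e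
*-distribʳ-^ m n zero    = refl
*-distribʳ-^ m n (suc e) =
  trans (cong (m * n *_) (*-distribʳ-^ m n e)) (interchange m n (m ^ e) (n ^ e))
  where
  interchange : ∀ a b c d → a * b * (c * d) ≡ a * c * (b * d)
  interchange = solve-∀

-- Abstract, lest 3 ^ e be unfolded for the large e to which this is applied.

abstract
  poly⇒monomial : ∀ {h} → IsPoly h →
                  ∃[ a ] ∃[ d ] (∀ n → h n ≤ a * n ^ d + a)
  -- For positive `n`, `2 + n ≤ 3 * n`, whence the factor `3 ^ e`; the summand `3 ^ e` takes care of
  -- `n = 0`.
  poly⇒monomial {h} (e , h≤) = 3 ^ e , e , bound
    where
    open ≤-Reasoning
    bound : ∀ n → h n ≤ 3 ^ e * n ^ e + 3 ^ e
    bound zero    = begin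
      h 0                    ≤⟨ h≤ 0 ⟩
      2 ^ e                  ≤⟨ ^-monoˡ-≤ e (n≤1+n 2) ⟩
      3 ^ e                  ≤⟨ m≤n+m _ _ ⟩
      3 ^ e * 0 ^ e + 3 ^ e  ∎
    bound (suc n) = begin
      h (suc n)                        ≤⟨ h≤ (suc n) ⟩
      (3 + n) ^ e                      ≤⟨ ^-monoˡ-≤ e (m+n≤o⇒m≤o (3 + n) {n + n} (≤-reflexive (tripled n))) ⟩
      (3 * suc n) ^ e                  ≡⟨ *-distribʳ-^ 3 (suc n) e ⟩
      3 ^ e * suc n ^ e                ≤⟨ m≤m+n _ _ ⟩
      3 ^ e * suc n ^ e + 3 ^ e        ∎
      where
      tripled : ∀ n → (3 + n) + (n + n) ≡ 3 * suc n
      tripled = solve-∀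

module _ {S : System} (T : PolynomialTime S) where
  open PolynomialTime T using (coefficient; degree; bound)

  poly-bound : IsPoly bound
  poly-bound = poly-+ (poly-* (poly-const coefficient) (poly-^ degree poly-id))
                      (poly-const coefficient)

  bound-mono : ∀ {m n} → m ≤ n → bound m ≤ bound n
  bound-mono m≤n =
    +-monoˡ-≤ coefficient (*-monoʳ-≤ coefficient (^-monoˡ-≤ degree m≤n))

-- Finite types and the number of computation paths

Boundable : Set → Set
Boundable A = (h : A → ℕ) → ∃[ b ] (∀ x → h x ≤ b)

boundable-Fin : ∀ n → Boundable (Fin n)
boundable-Fin zero    h = 0 , λ ()
boundable-Fin (suc n) h with boundable-Fin n (h ∘ suc)
... | b , h≤b = h zero ⊔ b , λ where
  zero    → m≤m⊔n (h zero) b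
  (suc i) → ≤-trans (h≤b i) (m≤n⊔m (h zero) b)

-- Boundedness passes to retracts, whereas `Finite` asks for a bijection; this keeps products and
-- vectors of symbols easy.
boundable-via : ∀ {A B : Set} (to : A → B) (from : B → A) →
                (∀ x → from (to x) ≡ x) → Boundable B → Boundable A
boundable-via to from inv bnd h with bnd (h ∘ from)
... | b , h≤b = b , λ x → subst (λ y → h y ≤ b) (inv x) (h≤b (to x))

boundable-finite : ∀ {A} → Finite A → Boundable A
boundable-finite (n , iso) =
  boundable-via to from strictlyInverseʳ (boundable-Fin n)
  where open Inverse iso

boundable-× : ∀ {A B} → Boundable A → Boundable B → Boundable (A × B)
boundable-× bA bB h with bA (λ x → proj₁ (bB (λ y → h (x , y))))
... | b , h≤b = b , λ (x , y) → ≤-trans (proj₂ (bB (λ y → h (x , y))) y) (h≤b x)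

boundable-Vec : ∀ {A} n → Boundable A → Boundable (Vec A n)
boundable-Vec zero    bA h = h [] , λ { [] → ≤-refl }
boundable-Vec (suc n) bA =
  boundable-via (λ { (x ∷ xs) → x , xs }) (λ (x , xs) → x ∷ xs)
                (λ { (x ∷ xs) → refl }) (boundable-× bA (boundable-Vec n bA))

boundable-Symbol : ∀ {A} → Boundable A → Boundable (Symbol A)
boundable-Symbol bA h with bA (h ∘ aux)
... | b , h≤b = h blank ⊔ (h (bit false) ⊔ (h (bit true) ⊔ b)) , λ where
  blank       → m≤m⊔n _ _
  (bit false) → ≤-trans (m≤m⊔n _ _) (m≤n⊔m (h blank) _)
  (bit true)  → ≤-trans (m≤m⊔n _ _) (≤-trans (m≤n⊔m (h (bit false)) _) (m≤n⊔m (h blank) _))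
  (aux x)     → ≤-trans (h≤b x) (≤-trans (m≤n⊔m (h (bit true)) _)
                  (≤-trans (m≤n⊔m (h (bit false)) _) (m≤n⊔m (h blank) _)))

finite-⊎ : ∀ {A B} → Finite A → Finite B → Finite (A ⊎ B)
finite-⊎ (m , A↔m) (n , B↔n) = m + n , ↔.↔-trans (A↔m ⊎-↔ B↔n) (↔.↔-sym +↔⊎)

finite-× : ∀ {A B} → Finite A → Finite B → Finite (A × B)
finite-× (m , A↔m) (n , B↔n) = m * n , ↔.↔-trans (A↔m ×-↔ B↔n) (↔.↔-sym *↔×)

finite-Bool : Finite Bool
finite-Bool = 2 , ↔.↔-sym 2↔Bool

finite-listed : ∀ {A n} (xs : Vec A n) (index : A → Fin n) →
                (∀ x → Vec.lookup xs (index x) ≡ x) →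
                {True (all? (λ i → index (Vec.lookup xs i) ≟ i))} → Finite A
finite-listed {n = n} xs index inv {ok} =
  n , mk↔ₛ′ index (Vec.lookup xs) (toWitness ok) inv

module _ {S : System} where
  open System S

  length-paths : ∀ {b} → 1 ≤ b → (∀ c → length (step c) ≤ b) →
                 ∀ t c → length (paths S t c) ≤ b ^ t
  length-paths 1≤b step≤ zero c with null (step c)
  ... | true  = ≤-refl
  ... | false = z≤n
  length-paths {b@(suc _)} 1≤b step≤ (suc t) c with null (step c)
  ... | true  = m^n>0 b (suc t)
  ... | false = begin
    length (map (c ⟶_) (concatMap (paths S t) (step c))) ≡⟨ length-map (c ⟶_) (concatMap (paths S t) (step c)) ⟩
    length (concatMap (paths S t) (step c))              ≤⟨ length-concat (step c) ⟩
    length (step c) * b ^ t                              ≤⟨ *-monoˡ-≤ (b ^ t) (step≤ c) ⟩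
    b * b ^ t                                            ∎
    where
    open ≤-Reasoning
    length-concat : ∀ cs → length (concatMap (paths S t) cs) ≤ length cs * b ^ t
    length-concat []       = z≤n
    length-concat (c ∷ cs) = begin
      length (concatMap (paths S t) (c ∷ cs))                       ≡⟨ length-++ (paths S t c) ⟩
      length (paths S t c) + length (concatMap (paths S t) cs)      ≤⟨ +-mono-≤ (length-paths 1≤b step≤ t c) (length-concat cs) ⟩
      b ^ t + length cs * b ^ t                                     ∎

length-filterᵇ : ∀ {A : Set} (p : A → Bool) xs → length (filterᵇ p xs) ≤ length xs
length-filterᵇ p []       = z≤n
length-filterᵇ p (x ∷ xs) with p x
... | true  = s≤s (length-filterᵇ p xs)
... | false = m≤n⇒m≤1+n (length-filterᵇ p xs)

m≤2^m : ∀ m → m ≤ 2 ^ m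
m≤2^m m = m≤[2+n]^m m 0

-- A transition depends only on a state and finitely many symbols, so a constant bounds the
-- branching, and the number of paths is at most exponential in the time. Hence values of #P
-- functions have polynomially many binary digits, which is what makes guessing them feasible.
acc-bound : ∀ {k} (M : Machine k) (T : PolynomialTime (plain M)) →
            ∃[ b ] (∀ x → PolynomialTime.acc T x ≤ 2 ^ (b * PolynomialTime.bound T (length x)))
acc-bound {k} M T
  with boundable-× (boundable-finite (Machine.finite-State M))
         (boundable-Vec (suc k) (boundable-Symbol (boundable-finite (Machine.finite-Aux M))))
         (λ (s , hs) → length (Machine.δ M s hs))
... | b , δ≤b = suc b , λ x → begin
    acc x                                ≤⟨ length-filterᵇ _ (computationPaths x) ⟩
    length (computationPaths x)          ≤⟨ length-paths {plain M} {suc b} (s≤s z≤n) step≤ (bound (length x)) _ ⟩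
    suc b ^ bound (length x)             ≤⟨ ^-monoˡ-≤ (bound (length x)) (m≤2^m (suc b)) ⟩
    (2 ^ suc b) ^ bound (length x)       ≡⟨ ^-*-assoc 2 (suc b) (bound (length x)) ⟩
    2 ^ (suc b * bound (length x))       ∎
  where
  open PolynomialTime T
  open ≤-Reasoning
  step≤ : ∀ c → length (Machine.step M c) ≤ suc b
  step≤ (s , ts) = ≤-trans (≤-reflexive (length-map _ (Machine.δ M s (Vec.map Tape.head ts))))
                     (m≤n⇒m≤1+n (δ≤b (s , Vec.map Tape.head ts)))

-- Binary numerals

bitValue : Bool → ℕ
bitValue b = if b then 1 else 0

-- Digit lists are least significant first.

value : List Bool → ℕ
value []       = 0
value (b ∷ ds) = bitValue b + (value ds + value ds)

-- The value of the negated digits, `2 ^ length ds - 1 - value ds`: a nonnegative substitute for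
-- subtracting `value ds`.
complement : List Bool → ℕ
complement []       = 0
complement (b ∷ ds) = bitValue (not b) + (complement ds + complement ds)

value+complement : ∀ ds → suc (value ds + complement ds) ≡ 2 ^ length ds
value+complement []       = refl
value+complement (b ∷ ds) = trans (shuffle b) (cong (2 *_) (value+complement ds))
  where
  one : ∀ v c → suc (suc (v + v) + (c + c)) ≡ 2 * suc (v + c)
  one = solve-∀
  zer : ∀ v c → suc ((v + v) + suc (c + c)) ≡ 2 * suc (v + c)
  zer = solve-∀
  shuffle : ∀ b → suc (value (b ∷ ds) + complement (b ∷ ds)) ≡
                  2 * suc (value ds + complement ds)
  shuffle true  = one (value ds) (complement ds)
  shuffle false = zer (value ds) (complement ds)

value<2^length : ∀ ds → value ds < 2 ^ length ds
value<2^length ds = ≤-trans (s≤s (m≤m+n _ _)) (≤-reflexive (value+complement ds))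

-- The numerals of positive numbers: the most significant digit, which comes last, is 1. Such
-- numerals are determined by their values.
data Positive : List Bool → Set where
  one : Positive [ true ]
  _∷_ : ∀ b {ds} → Positive ds → Positive (b ∷ ds)

increment-positive : ∀ {ds} → Positive ds → Positive (increment ds)
increment-positive one          = false ∷ one
increment-positive (false ∷ ps) = true ∷ ps
increment-positive (true ∷ ps)  = false ∷ increment-positive ps

binaryLSB-positive : ∀ n → Positive (binaryLSB (suc n))
binaryLSB-positive zero    = one
binaryLSB-positive (suc n) = increment-positive (binaryLSB-positive n)

value-increment : ∀ ds → value (increment ds) ≡ suc (value ds)
value-increment []           = refl
value-increment (false ∷ ds) = refl
value-increment (true ∷ ds)  rewrite value-increment ds = cong suc (+-suc (value ds) (value ds))

value-binaryLSB : ∀ n → value (binaryLSB n) ≡ n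
value-binaryLSB zero    = refl
value-binaryLSB (suc n) = trans (value-increment (binaryLSB n)) (cong suc (value-binaryLSB n))

value-positive : ∀ {ds} → Positive ds → ∃[ n ] value ds ≡ suc n
value-positive one          = 0 , refl
value-positive (true ∷ ps)  = _ , refl
value-positive (false ∷ ps) with value-positive ps
... | n , eq rewrite eq = _ , refl

-- Raising `n` by one raises `n + n` by two, and two increments of `false ∷ ds` amount to one
-- increment of `ds`.
binaryLSB-double : ∀ n → binaryLSB (suc n + suc n) ≡ false ∷ binaryLSB (suc n)
binaryLSB-double zero    = refl
binaryLSB-double (suc n) rewrite +-suc n (suc n) =
  cong (increment ∘ increment) (binaryLSB-double n)

positive-length : ∀ {ds} → Positive ds → 1 ≤ length ds
positive-length one      = s≤s z≤n
positive-length (_ ∷ ps) = s≤s z≤n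

binaryLSB-∷ : ∀ b n → binaryLSB (bitValue b + (suc n + suc n)) ≡ b ∷ binaryLSB (suc n)
binaryLSB-∷ true  n = cong increment (binaryLSB-double n)
binaryLSB-∷ false n = binaryLSB-double n

binaryLSB-value : ∀ {ds} → Positive ds → binaryLSB (value ds) ≡ ds
binaryLSB-value one = refl
binaryLSB-value {_ ∷ ds} (b ∷ ps) with value ds | value-positive ps | binaryLSB-value ps
... | _ | n , refl | eq = trans (binaryLSB-∷ b n) (cong (b ∷_) eq)

2^length≤ : ∀ {ds} → Positive ds → 2 ^ length ds ≤ value ds + value ds
2^length≤ one = ≤-refl
2^length≤ {_ ∷ ds} (b ∷ ps) = begin
  2 * 2 ^ length ds                             ≤⟨ *-monoʳ-≤ 2 (2^length≤ ps) ⟩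
  2 * (value ds + value ds)                     ≡⟨ cong ((value ds + value ds) +_) (+-identityʳ _) ⟩
  (value ds + value ds) + (value ds + value ds) ≤⟨ +-mono-≤ (m≤n+m _ (bitValue b)) (m≤n+m _ (bitValue b)) ⟩
  value (b ∷ ds) + value (b ∷ ds)               ∎
  where open ≤-Reasoning

length-positive : ∀ {ds j} → Positive ds → value ds < 2 ^ j → length ds ≤ j
length-positive {ds} {j} ps v< = ≮⇒≥ λ j<len → <-irrefl refl (begin-strict
  2 ^ length ds       ≤⟨ 2^length≤ ps ⟩
  value ds + value ds <⟨ +-mono-< v< v< ⟩
  2 ^ j + 2 ^ j       ≡⟨ cong (2 ^ j +_) (+-identityʳ _) ⟨
  2 ^ suc j           ≤⟨ ^-monoʳ-≤ 2 j<len ⟩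
  2 ^ length ds       ∎)
  where open ≤-Reasoning

length-binaryLSB : ∀ {n j} → n < 2 ^ suc j → length (binaryLSB n) ≤ suc j
length-binaryLSB {zero}      _  = s≤s z≤n
length-binaryLSB {suc n} {j} n< =
  length-positive (binaryLSB-positive n)
    (subst (_< 2 ^ suc j) (sym (value-binaryLSB (suc n))) n<)

and-++ : ∀ xs ys → and (xs ++ ys) ≡ and xs ∧ and ys
and-++ []       ys = refl
and-++ (x ∷ xs) ys = trans (cong (x ∧_) (and-++ xs ys)) (sym (∧-assoc x _ _))

and-reverse : ∀ xs → and (reverse xs) ≡ and xs
and-reverse []       = refl
and-reverse (x ∷ xs) = begin
  and (reverse (x ∷ xs))      ≡⟨ cong and (unfold-reverse x xs) ⟩
  and (reverse xs ++ [ x ])   ≡⟨ and-++ (reverse xs) [ x ] ⟩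
  and (reverse xs) ∧ (x ∧ true) ≡⟨ cong₂ _∧_ (and-reverse xs) (∧-identityʳ x) ⟩
  and xs ∧ x                  ≡⟨ ∧-comm (and xs) x ⟩
  x ∧ and xs                  ∎
  where open ≡-Reasoning

and⇒complement : ∀ ds → and ds ≡ true → complement ds ≡ 0
and⇒complement []          _  = refl
and⇒complement (true ∷ ds) eq rewrite and⇒complement ds eq = refl

and-ones : ∀ j → and (replicate j true) ≡ true
and-ones zero    = refl
and-ones (suc j) = and-ones j

positive-ones : ∀ j → Positive (replicate (suc j) true)
positive-ones zero    = one
positive-ones (suc j) = true ∷ positive-ones j

and-binary⇒ : ∀ n → and (binary n) ≡ true → ∃[ j ] suc n ≡ 2 ^ j
and-binary⇒ n ones = length (binaryLSB n) , (begin
  suc n                                              ≡⟨ cong suc (value-binaryLSB n) ⟨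
  suc (value (binaryLSB n))                          ≡⟨ cong suc (+-identityʳ _) ⟨
  suc (value (binaryLSB n) + 0)                      ≡⟨ cong (λ c → suc (value (binaryLSB n) + c)) (and⇒complement (binaryLSB n) ones′) ⟨
  suc (value (binaryLSB n) + complement (binaryLSB n)) ≡⟨ value+complement (binaryLSB n) ⟩
  2 ^ length (binaryLSB n)                           ∎)
  where
  open ≡-Reasoning
  ones′ : and (binaryLSB n) ≡ true
  ones′ = trans (sym (and-reverse (binaryLSB n))) ones

-- The exponent has to be positive: `suc 0 ≡ 2 ^ 0`, but the numeral of 0 is the digit 0.
and-binary⇐ : ∀ {n j} → suc n ≡ 2 ^ suc j → and (binary n) ≡ true
and-binary⇐ {n} {j} eq = begin
  and (binary n)          ≡⟨ and-reverse (binaryLSB n) ⟩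
  and (binaryLSB n)       ≡⟨ cong (and ∘ binaryLSB) n≡ ⟩
  and (binaryLSB (value ones)) ≡⟨ cong and (binaryLSB-value (positive-ones j)) ⟩
  and ones                ≡⟨ and-ones (suc j) ⟩
  true                    ∎
  where
  open ≡-Reasoning
  ones = replicate (suc j) true
  n≡ : n ≡ value ones
  n≡ = suc-injective (begin
    suc n                              ≡⟨ eq ⟩
    2 ^ suc j                          ≡⟨ cong (2 ^_) (length-replicate (suc j)) ⟨
    2 ^ length ones                    ≡⟨ value+complement ones ⟨
    suc (value ones + complement ones) ≡⟨ cong (λ c → suc (value ones + c)) (and⇒complement ones (and-ones (suc j))) ⟩
    suc (value ones + 0)               ≡⟨ cong suc (+-identityʳ _) ⟩
    suc (value ones)                   ∎)

-- Tapes

module _ {A : Set} where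

  at : List (Symbol A) → List (Symbol A) → Tape A
  at l []      = tape l blank []
  at l (s ∷ r) = tape l s r

  at-writeWord : ∀ u → writeWord u ≡ at [] (map bit u)
  at-writeWord []      = refl
  at-writeWord (b ∷ u) = refl

  moveRight-at : ∀ l s r → move moveRight (tape l s r) ≡ at (s ∷ l) r
  moveRight-at l s []      = refl
  moveRight-at l s (h ∷ r) = refl

  right-moveLeft : ∀ (t : Tape A) → right (move moveLeft t) ≡ head t ∷ right t
  right-moveLeft (tape []      h r) = refl
  right-moveLeft (tape (_ ∷ l) h r) = refl

  left-moveRight : ∀ (t : Tape A) → left (move moveRight t) ≡ head t ∷ left t
  left-moveRight (tape l h [])      = refl
  left-moveRight (tape l h (_ ∷ r)) = refl

  length-right-act : ∀ sm (t : Tape A) → length (right (act sm t)) ≤ suc (length (right t))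
  length-right-act (s , moveLeft) (tape []      h r) = ≤-refl
  length-right-act (s , moveLeft) (tape (_ ∷ l) h r) = ≤-refl
  length-right-act (s , stay)     (tape l h r)       = n≤1+n _
  length-right-act (s , moveRight) (tape l h [])      = z≤n
  length-right-act (s , moveRight) (tape l h (_ ∷ r)) = m≤n⇒m≤1+n (n≤1+n _)

  length-bitPrefix : ∀ (ss : List (Symbol A)) → length (bitPrefix ss) ≤ length ss
  length-bitPrefix []           = z≤n
  length-bitPrefix (blank ∷ ss) = z≤n
  length-bitPrefix (bit b ∷ ss) = s≤s (length-bitPrefix ss)
  length-bitPrefix (aux _ ∷ ss) = z≤n

  bitPrefix-map : ∀ (u : Word) → bitPrefix {A} (map bit u) ≡ u
  bitPrefix-map []      = refl
  bitPrefix-map (b ∷ u) = cong (b ∷_) (bitPrefix-map u)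

  keep : Symbol A → Symbol A × Move
  keep s = s , stay

  keep-all : ∀ {n} (ts : Vec (Tape A) n) →
             zipWith act (Vec.map keep (Vec.map head ts)) ts ≡ ts
  keep-all []       = refl
  keep-all (t ∷ ts) = cong (t ∷_) (keep-all ts)

  -- An input tape after its head has visited both blank ends of the word.

  swept : Word → Tape A
  swept u = at [ blank ] (map bit u ++ [ blank ])

-- The simulating machine adds two symbols to the alphabet, used as walls: what
-- lies beyond a wall is garbage standing for blank cells.

Walled : Set → Set
Walled A = A ⊎ Bool

module _ {A : Set} where

  embed : Symbol A → Symbol (Walled A)
  embed blank   = blank
  embed (bit b) = bit b
  embed (aux x) = aux (inj₁ x)

  -- The value on walls is irrelevant.

  unembed : Symbol (Walled A) → Symbol A
  unembed blank          = blank
  unembed (bit b)        = bit b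
  unembed (aux (inj₁ x)) = aux x
  unembed (aux (inj₂ _)) = blank

  unembed-embed : ∀ s → unembed (embed s) ≡ s
  unembed-embed blank   = refl
  unembed-embed (bit b) = refl
  unembed-embed (aux x) = refl

  wall : Bool → Symbol (Walled A)
  wall b = aux (inj₂ b)

  -- Side w cs cs′: the cells cs on one side of a head are represented by cs′,
  -- where the represented part may be delimited by the wall w.

  data Side (w : Maybe Bool) : List (Symbol A) → List (Symbol (Walled A)) → Set where
    fresh  : Side w [] []
    padded : ∀ {cs} → Side w [] cs → Side w [] (blank ∷ cs)
    walled : ∀ {b g} → w ≡ just b → Side w [] (wall b ∷ g)
    _∷_    : ∀ s {cs cs′} → Side w cs cs′ → Side w (s ∷ cs) (embed s ∷ cs′)

  data Represents (wl wr : Maybe Bool) : Tape A → Tape (Walled A) → Set where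
    rep : ∀ {l h r l′ r′} → Side wl l l′ → Side wr r r′ →
          Represents wl wr (tape l h r) (tape l′ (embed h) r′)

  -- After a move the simulating head may be on a wall.

  data Reaches (wl wr : Maybe Bool) : Tape A → Tape (Walled A) → Set where
    inside  : ∀ {t t′} → Represents wl wr t t′ → Reaches wl wr t t′
    atLeft  : ∀ {b r r′ g} → wl ≡ just b → Side wr r r′ →
              Reaches wl wr (tape [] blank r) (tape g (wall b) r′)
    atRight : ∀ {b l l′ g} → wr ≡ just b → Side wl l l′ →
              Reaches wl wr (tape l blank []) (tape l′ (wall b) g)

  act-reaches : ∀ {wl wr t t′} s m → Represents wl wr t t′ →
                Reaches wl wr (act (s , m) t) (act (embed s , m) t′)
  act-reaches s stay      (rep sl sr)            = inside (rep sl sr)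
  act-reaches s moveLeft  (rep fresh sr)         = inside (rep fresh (s ∷ sr))
  act-reaches s moveLeft  (rep (padded sl) sr)   = inside (rep sl (s ∷ sr))
  act-reaches s moveLeft  (rep (walled eq) sr)   = atLeft eq (s ∷ sr)
  act-reaches s moveLeft  (rep (_ ∷ sl) sr)      = inside (rep sl (s ∷ sr))
  act-reaches s moveRight (rep sl fresh)         = inside (rep (s ∷ sl) fresh)
  act-reaches s moveRight (rep sl (padded sr))   = inside (rep (s ∷ sl) sr)
  act-reaches s moveRight (rep sl (walled eq))   = atRight eq (s ∷ sl)
  act-reaches s moveRight (rep sl (_ ∷ sr))      = inside (rep (s ∷ sl) sr)

  reaches-inside : ∀ {t t′} → Reaches nothing nothing t t′ → Represents nothing nothing t t′
  reaches-inside (inside r) = r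

  act-represents : ∀ {t t′} s m → Represents nothing nothing t t′ →
                   Represents nothing nothing (act (s , m) t) (act (embed s , m) t′)
  act-represents s m r = reaches-inside (act-reaches s m r)

  side-++ : ∀ {w cs} u → Side w [] cs → Side w (map bit u) (map bit u ++ cs)
  side-++ []      s = s
  side-++ (b ∷ u) s = bit b ∷ side-++ u s

  swept-represents : ∀ {wl wr} u → Represents wl wr (writeWord u) (swept u)
  swept-represents []      = rep (padded fresh) fresh
  swept-represents (b ∷ u) = rep (padded fresh) (side-++ u (padded fresh))

  empty-represents : ∀ {wl wr} → Represents wl wr emptyTape emptyTape
  empty-represents = rep fresh fresh

  bitPrefix-side : ∀ {cs cs′} → Side nothing cs cs′ → bitPrefix cs′ ≡ bitPrefix cs
  bitPrefix-side fresh         = refl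
  bitPrefix-side (padded s)    = refl
  bitPrefix-side (blank ∷ s)   = refl
  bitPrefix-side (bit b ∷ s)   = cong (b ∷_) (bitPrefix-side s)
  bitPrefix-side (aux _ ∷ s)   = refl

  readWord-represents : ∀ {t t′} → Represents nothing nothing t t′ →
                        readWord t′ ≡ readWord t
  readWord-represents (rep {h = h} sl sr) = bitPrefix-side (h ∷ sr)

  heads-represent : ∀ {wl wr t t′} → Represents wl wr t t′ → unembed (head t′) ≡ head t
  heads-represent (rep _ _) = unembed-embed _

  data AllRepresent : ∀ {n} → Vec (Tape A) n → Vec (Tape (Walled A)) n → Set where
    []  : AllRepresent [] []
    _∷_ : ∀ {n t t′} {ts : Vec _ n} {ts′} → Represents nothing nothing t t′ →
          AllRepresent ts ts′ → AllRepresent (t ∷ ts) (t′ ∷ ts′)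

  embedAct : Symbol A × Move → Symbol (Walled A) × Move
  embedAct (s , m) = embed s , m

  act-all-represent : ∀ {n ts ts′} (as : Vec (Symbol A × Move) n) → AllRepresent ts ts′ →
                      AllRepresent (zipWith act as ts) (zipWith act (Vec.map embedAct as) ts′)
  act-all-represent []             []       = []
  act-all-represent ((s , m) ∷ as) (r ∷ rs) = act-represents s m r ∷ act-all-represent as rs

  all-heads-represent : ∀ {n} {ts : Vec (Tape A) n} {ts′} → AllRepresent ts ts′ →
                        Vec.map unembed (Vec.map head ts′) ≡ Vec.map head ts
  all-heads-represent []       = refl
  all-heads-represent (r ∷ rs) = cong₂ _∷_ (heads-represent r) (all-heads-represent rs)

  empty-all-represent : ∀ n → AllRepresent (Vec.replicate n emptyTape) (Vec.replicate n emptyTape)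
  empty-all-represent zero    = []
  empty-all-represent (suc n) = empty-represents ∷ empty-all-represent n

perform : ∀ {S A : Set} {n} → Vec (Tape A) n → S × Vec (Symbol A × Move) n → S × Vec (Tape A) n
perform ts (s , as) = s , zipWith act as ts

-- The function queried

-- A query word is a sequence of digits `0 b` and blocks `1 (1 b)* 0`, the
-- latter holding queries y to f.  A digit doubles the worth of what follows it
-- and adds the complement of b; a block adds f y.

module _ (f : Word → ℕ) where
  mutual
    worth : Word → ℕ
    worth []          = 0
    worth (false ∷ w) = worthDigit w
    worth (true ∷ w)  = worthSkip w + worthLoad [] w

    worthDigit : Word → ℕ
    worthDigit []      = 0
    worthDigit (b ∷ w) = worth w + (worth w + bitValue (not b))

    worthSkip : Word → ℕ
    worthSkip []          = 0
    worthSkip (false ∷ w) = worth w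
    worthSkip (true ∷ w)  = worthSkipBit w

    worthSkipBit : Word → ℕ
    worthSkipBit []      = 0
    worthSkipBit (_ ∷ w) = worthSkip w

    worthLoad : Word → Word → ℕ
    worthLoad r []          = 0
    worthLoad r (false ∷ w) = f (reverse r)
    worthLoad r (true ∷ w)  = worthLoadBit r w

    worthLoadBit : Word → Word → ℕ
    worthLoadBit r []      = 0
    worthLoadBit r (b ∷ w) = worthLoad (b ∷ r) w

-- Counting accepting paths

acceptanceCount : Counting
acceptanceCount = record
  { Value = ℕ ; _∙_ = _+_ ; ε = 0 ; isMonoid = +-0-isMonoid
  ; weight = bitValue
  ; void = [ false ] ; void-nonempty = refl ; void-total = refl
  }

length-filterᵇ-accept : ∀ {A : Set} (p : A → Bool) xs →
  length (filterᵇ p xs) ≡ Counting.total acceptanceCount (map (bitValue ∘ p) xs)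
length-filterᵇ-accept p []       = refl
length-filterᵇ-accept p (x ∷ xs) with p x
... | true  = cong suc (length-filterᵇ-accept p xs)
... | false = length-filterᵇ-accept p xs

acc-tally : ∀ {S : System} (T : PolynomialTime S) x → PolynomialTime.acc T x ≡
            Counting.tally acceptanceCount S (PolynomialTime.bound T (length x)) (System.initial S x)
acc-tally {S} T x = length-filterᵇ-accept (accepts S) (PolynomialTime.computationPaths T x)

-- The machine counting `worth f` for f in #P: it guesses where the contribution
-- to be counted is, branching on the digits passed, and runs the machine for f
-- if that is a block.

data Phase : Set where
  scan digit skip skipBit load loadBit rewind accept : Phase

finite-Phase : Finite Phase
finite-Phase = finite-listed
  (scan ∷ digit ∷ skip ∷ skipBit ∷ load ∷ loadBit ∷ rewind ∷ accept ∷ [])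
  (λ where scan → 0F ; digit → 1F ; skip → 2F ; skipBit → 3F
           load → 4F ; loadBit → 5F ; rewind → 6F ; accept → 7F)
  (λ where scan → refl ; digit → refl ; skip → refl ; skipBit → refl
           load → refl ; loadBit → refl ; rewind → refl ; accept → refl)

module Worth {k} (M : Machine k) (T : PolynomialTime (plain M)) where

  open PolynomialTime T using (bound; halts)
  module M = Machine M

  f : Word → ℕ
  f = PolynomialTime.acc T

  Aux = Walled M.Aux
  State = Phase ⊎ M.State

  pattern phase p = inj₁ p
  pattern exec s  = inj₂ s

  Action : Set
  Action = State × Vec (Symbol Aux × Move) (2 + k)

  advance : ∀ {n} → Symbol Aux → Vec (Symbol Aux) n → State → State × Vec (Symbol Aux × Move) (suc n)
  advance w zs s = s , (w , moveRight) ∷ Vec.map keep zs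

  δ : State → Vec (Symbol Aux) (2 + k) → List Action
  δ (phase scan)    (w@(bit false) ∷ zs)  = [ advance w zs (phase digit) ]
  δ (phase scan)    (w@(bit true) ∷ zs)   = map (advance w zs) (phase skip ∷ phase load ∷ [])
  δ (phase digit)   (w@(bit false) ∷ zs)  =
    map (advance w zs) (phase scan ∷ phase scan ∷ phase accept ∷ [])
  δ (phase digit)   (w@(bit true) ∷ zs)   = map (advance w zs) (phase scan ∷ phase scan ∷ [])
  δ (phase skip)    (w@(bit false) ∷ zs)  = [ advance w zs (phase scan) ]
  δ (phase skip)    (w@(bit true) ∷ zs)   = [ advance w zs (phase skipBit) ]
  δ (phase skipBit) (w@(bit _) ∷ zs)      = [ advance w zs (phase skip) ]
  δ (phase load)    (w@(bit false) ∷ z ∷ zs) =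
    [ phase rewind , (w , moveRight) ∷ (z , moveLeft) ∷ Vec.map keep zs ]
  δ (phase load)    (w@(bit true) ∷ zs)   = [ advance w zs (phase loadBit) ]
  δ (phase loadBit) (w@(bit b) ∷ z ∷ zs)  =
    [ phase load , (w , moveRight) ∷ (bit b , moveRight) ∷ Vec.map keep zs ]
  δ (phase rewind)  (w ∷ z@(bit _) ∷ zs)  =
    [ phase rewind , keep w ∷ (z , moveLeft) ∷ Vec.map keep zs ]
  δ (phase rewind)  (w ∷ z ∷ zs)          =
    [ exec M.start , keep w ∷ (z , moveRight) ∷ Vec.map keep zs ]
  δ (exec s)        (w ∷ zs)              =
    map (λ (s′ , as) → exec s′ , keep w ∷ Vec.map embedAct as) (M.δ s (Vec.map unembed zs))
  δ _               _                     = []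

  machine : Machine (suc k)
  machine = record
    { State = State ; Aux = Aux
    ; finite-State = finite-⊎ finite-Phase M.finite-State
    ; finite-Aux = finite-⊎ M.finite-Aux finite-Bool
    ; start = phase scan
    ; accepting = λ { (phase accept) → true ; (phase _) → false ; (exec s) → M.accepting s }
    ; δ = δ
    }

  open Machine machine using (Config; step)
  module RunsM = Runs acceptanceCount (plain M)
  open Runs acceptanceCount (plain machine)

  simulated : ∀ {n} → Symbol Aux → M.State × Vec (Symbol M.Aux × Move) n →
              State × Vec (Symbol Aux × Move) (suc n)
  simulated w (s , as) = exec s , keep w ∷ Vec.map embedAct as

  module _ {W : Tape Aux} where
    mutual
      -- Since `unembed` undoes `embed` on the scanned symbols, both machines choose from the same
      -- list of transitions. They proceed in lockstep with equal branching, hence with equal time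
      -- and value.
      exec-run : ∀ {t q s ts ts′ v} → AllRepresent ts ts′ → RunsM.Run t q (s , ts) v →
                 Run t 0 (exec s , W ∷ ts′) v
      exec-run {s = s} {ts} {ts′} reps (RunsM.halt eq _) = halt halted z≤n
        where
        no-moves : ∀ trs → map (perform ts) trs ≡ [] → trs ≡ []
        no-moves [] _ = refl
        halted : step (exec s , W ∷ ts′) ≡ []
        halted rewrite all-heads-represent reps | no-moves (M.δ s (Vec.map head ts)) eq = refl
      exec-run {s = s} {ts} {ts′} {v} reps (RunsM.go {t} {q} eq _ runs) =
        go-all nonempty z≤n (exec-moves trs′ reps (subst (λ cs → RunsM.Runs t q cs v) (sym eq′) runs))
        where
        trs′ = M.δ s (Vec.map unembed (Vec.map head ts′))
        eq′ : map (perform ts) trs′ ≡ _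
        eq′ = trans (cong (λ hs → map (perform ts) (M.δ s hs)) (all-heads-represent reps)) eq
        nonempty : null (step (exec s , W ∷ ts′)) ≡ false
        nonempty with M.δ s (Vec.map unembed (Vec.map head ts′)) | eq′
        ... | _ ∷ _ | _ = refl

      exec-moves : ∀ {t q ts ts′ v} trs → AllRepresent ts ts′ →
        RunsM.Runs t q (map (perform ts) trs) v →
        Runs t 0 (map (perform (W ∷ ts′)) (map (simulated (head W)) trs)) v
      exec-moves [] reps RunsM.[] = []
      exec-moves ((_ , as) ∷ trs) reps (run RunsM.∷ runs) =
        exec-run (act-all-represent as reps) run ∷ exec-moves trs reps runs

  loading : Word → Vec (Tape Aux) (suc k)
  loading r = tape (map bit r) blank [] ∷ Vec.replicate k emptyTape

  advance-step : ∀ p b {l w} {Zs : Vec (Tape Aux) (suc k)} ss →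
    δ (phase p) (bit b ∷ Vec.map head Zs) ≡ map (advance (bit b) (Vec.map head Zs)) ss →
    step (phase p , at l (map bit (b ∷ w)) ∷ Zs) ≡ map (_, at (bit b ∷ l) (map bit w) ∷ Zs) ss
  advance-step p b {l} {w} {Zs} ss eq rewrite eq = all ss
    where
    all : ∀ ss → map (perform (tape l (bit b) (map bit w) ∷ Zs)) (map (advance (bit b) (Vec.map head Zs)) ss)
                 ≡ map (_, at (bit b ∷ l) (map bit w) ∷ Zs) ss
    all []       = refl
    all (s ∷ ss) = cong₂ _∷_
      (cong₂ (λ W′ Zs′ → s , W′ ∷ Zs′) (moveRight-at l (bit b) (map bit w)) (keep-all Zs)) (all ss)

  module Timed (n : ℕ) where

    -- Time granted on top of reading the query word: it pays for moving back over the copied query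
    -- and for running the machine for `f` on it.
    total-time : ℕ
    total-time = n + 3 + bound n

    -- `r` is the part of the copied query left of the head, nearest bit first, and `u` the part
    -- already passed. The head turns at the blank before the word and has seen the one after it, so
    -- it leaves the tape `swept`.
    rewind-run : ∀ r {W s cs} u → length r + length u ≤ n → s ∷ cs ≡ map bit u ++ [ blank ] →
      Run (length r + suc (bound n)) 0
          (phase rewind , W ∷ move moveLeft (tape (map bit r) s cs) ∷ Vec.replicate k emptyTape)
          (f (r ʳ++ u))
    rewind-run [] {W} {s} {cs} u u≤n eq =
      run₁ (cong (λ Zs → [ exec M.start , W ∷ at [ blank ] (s ∷ cs) ∷ Zs ]) (keep-all (Vec.replicate k emptyTape))) z≤n
        (subst (λ cs → Run (bound n) 0 (exec M.start , W ∷ at [ blank ] cs ∷ Vec.replicate k emptyTape) (f u)) (sym eq)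
          (weaken (bound-mono T u≤n)
            (subst (Run _ 0 _) (sym (acc-tally T u))
              (exec-run (swept-represents u ∷ empty-all-represent k)
                (RunsM.halts-run (bound (length u)) (halts u))))))
    rewind-run (b ∷ r) {W} {s} {cs} u u≤n eq =
      run₁ (cong (λ Zs → [ phase rewind , W ∷ move moveLeft (tape (map bit r) (bit b) (s ∷ cs)) ∷ Zs ])
                 (keep-all (Vec.replicate k emptyTape))) z≤n
        (rewind-run r (b ∷ u) (≤-trans (≤-reflexive (+-suc (length r) (length u))) u≤n) (cong (bit b ∷_) eq))

    within : ∀ (r : Word) → length r ≤ n → length r + suc (bound n) ≤ total-time
    within r r≤n = ≤-trans (+-mono-≤ r≤n (s≤s (m≤n+m (bound n) 2))) (≤-reflexive (sym (+-assoc n 3 (bound n))))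

    mutual
      load-run : ∀ w r {l} → length w + length r ≤ n →
        Run (length w + total-time) 0 (phase load , at l (map bit w) ∷ loading r) (worthLoad f r w)
      load-run []          r w≤n = halt refl z≤n
      load-run (false ∷ w) r w≤n =
        run₁ (cong₂ (λ W Zs → [ phase rewind , W ∷ move moveLeft (tape (map bit r) blank []) ∷ Zs ])
                (moveRight-at _ _ _) (keep-all (Vec.replicate k emptyTape))) z≤n
          (weaken (≤-trans (within r (≤-trans (m≤n+m _ (suc (length w))) w≤n)) (m≤n+m _ (length w)))
            (rewind-run r [] (≤-trans (≤-reflexive (+-identityʳ _)) (≤-trans (m≤n+m _ (suc (length w))) w≤n)) refl))
      load-run (true ∷ w)  r w≤n =
        run₁ (advance-step load true {w = w} [ _ ] refl) z≤n (loadBit-run w r (<⇒≤ w≤n))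

      loadBit-run : ∀ w r {l} → length w + length r ≤ n →
        Run (length w + total-time) 0 (phase loadBit , at l (map bit w) ∷ loading r) (worthLoadBit f r w)
      loadBit-run []      r w≤n = halt refl z≤n
      loadBit-run (b ∷ w) r w≤n =
        run₁ (cong₂ (λ W Zs → [ phase load , W ∷ tape (map bit (b ∷ r)) blank [] ∷ Zs ])
                (moveRight-at _ _ _) (keep-all (Vec.replicate k emptyTape))) z≤n
          (load-run w (b ∷ r) (≤-trans (≤-reflexive (+-suc (length w) (length r))) w≤n))

    mutual
      scan-run : ∀ w {l} → length w ≤ n →
        Run (length w + total-time) 0 (phase scan , at l (map bit w) ∷ loading []) (worth f w)
      scan-run []          w≤n = halt refl z≤n
      scan-run (false ∷ w) w≤n =
        run₁ (advance-step scan false {w = w} [ _ ] refl) z≤n (digit-run w (<⇒≤ w≤n))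
      scan-run (true ∷ w)  {l} w≤n =
        subst (Run (suc (length w + total-time)) 0 (phase scan , at l (map bit (true ∷ w)) ∷ loading []))
          (cong (worthSkip f w +_) (+-identityʳ _))
          (go (advance-step scan true {w = w} (_ ∷ _ ∷ []) refl) z≤n
            (skip-run w (<⇒≤ w≤n) ∷ load-run w [] (≤-trans (≤-reflexive (+-identityʳ _)) (<⇒≤ w≤n)) ∷ []))

      digit-run : ∀ w {l} → length w ≤ n →
        Run (length w + total-time) 0 (phase digit , at l (map bit w) ∷ loading []) (worthDigit f w)
      digit-run []          w≤n = halt refl z≤n
      digit-run (false ∷ w) w≤n =
        go (advance-step digit false {w = w} (_ ∷ _ ∷ _ ∷ []) refl) z≤n
          (scan-run w (<⇒≤ w≤n) ∷ scan-run w (<⇒≤ w≤n) ∷ halt refl z≤n ∷ [])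
      digit-run (true ∷ w)  w≤n =
        go (advance-step digit true {w = w} (_ ∷ _ ∷ []) refl) z≤n
          (scan-run w (<⇒≤ w≤n) ∷ scan-run w (<⇒≤ w≤n) ∷ [])

      skip-run : ∀ w {l} → length w ≤ n →
        Run (length w + total-time) 0 (phase skip , at l (map bit w) ∷ loading []) (worthSkip f w)
      skip-run []          w≤n = halt refl z≤n
      skip-run (false ∷ w) w≤n =
        run₁ (advance-step skip false {w = w} [ _ ] refl) z≤n (scan-run w (<⇒≤ w≤n))
      skip-run (true ∷ w)  w≤n =
        run₁ (advance-step skip true {w = w} [ _ ] refl) z≤n (skipBit-run w (<⇒≤ w≤n))

      skipBit-run : ∀ w {l} → length w ≤ n →
        Run (length w + total-time) 0 (phase skipBit , at l (map bit w) ∷ loading []) (worthSkipBit f w)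
      skipBit-run []      w≤n = halt refl z≤n
      skipBit-run (b ∷ w) w≤n =
        run₁ (advance-step skipBit b {w = w} [ _ ] refl) z≤n (skip-run w (<⇒≤ w≤n))

  machine-time : ℕ → ℕ
  machine-time n = n + Timed.total-time n

  initial-run : ∀ w → Run (machine-time (length w)) 0 (Machine.initial machine w) (worth f w)
  initial-run w =
    subst (λ W → Run (machine-time (length w)) 0 (phase scan , W ∷ loading []) (worth f w))
      (sym (at-writeWord w)) (Timed.scan-run (length w) w ≤-refl)

  poly-machine-time : IsPoly machine-time
  poly-machine-time = poly-+ poly-id (poly-+ (poly-+ poly-id (poly-const 3)) (poly-bound T))

  polynomialTime : PolynomialTime (plain machine)
  polynomialTime = record
    { coefficient = proj₁ monomial
    ; degree      = proj₁ (proj₂ monomial)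
    ; halts       = λ w → run-halts (weaken (proj₂ (proj₂ monomial) (length w)) (initial-run w))
    }
    where monomial = poly⇒monomial poly-machine-time

  worth-∈-#P : #P (worth f)
  worth-∈-#P = suc k , machine , polynomialTime , λ w →
    sym (trans (acc-tally polynomialTime w)
      (run-tally (weaken (proj₂ (proj₂ (poly⇒monomial poly-machine-time)) (length w)) (initial-run w))))

-- Query words

-- Words under construction are kept with their last bit first.

pushBits : Word → Word → Word
pushBits []      rw = rw
pushBits (b ∷ u) rw = pushBits u (b ∷ true ∷ rw)

pushBlock : Word → Word → Word
pushBlock u rw = false ∷ pushBits u (true ∷ rw)

pushDigits : List Bool → Word → Word
pushDigits []       rw = rw
pushDigits (d ∷ ds) rw = pushDigits ds (d ∷ false ∷ rw)

pushDigits-++ : ∀ ds es rw → pushDigits (ds ++ es) rw ≡ pushDigits es (pushDigits ds rw)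
pushDigits-++ []       es rw = refl
pushDigits-++ (d ∷ ds) es rw = pushDigits-++ ds es (d ∷ false ∷ rw)

length-pushBits : ∀ u rw → length (pushBits u rw) ≡ 2 * length u + length rw
length-pushBits []      rw = refl
length-pushBits (b ∷ u) rw = trans (length-pushBits u (b ∷ true ∷ rw)) (arith (length u) (length rw))
  where
  arith : ∀ m n → 2 * m + (2 + n) ≡ 2 * (1 + m) + n
  arith = solve-∀

length-pushDigits : ∀ ds rw → length (pushDigits ds rw) ≡ 2 * length ds + length rw
length-pushDigits []       rw = refl
length-pushDigits (d ∷ ds) rw = trans (length-pushDigits ds (d ∷ false ∷ rw)) (arith (length ds) (length rw))
  where
  arith : ∀ m n → 2 * m + (2 + n) ≡ 2 * (1 + m) + n
  arith = solve-∀

value-padded : ∀ ds j → value (ds ++ replicate j false) ≡ value ds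
value-padded []       zero    = refl
value-padded []       (suc j) = cong (λ v → v + v) (value-padded [] j)
value-padded (d ∷ ds) j       = cong (λ v → bitValue d + (v + v)) (value-padded ds j)

-- Detecting wrong answers by divisibility

module Ledger (f : Word → ℕ) where

  -- A recorded word acts on the worth of whatever follows as the affine map `x ↦ v + 2 ^ k * x`, so
  -- appending an answer only updates `v` and `k`.
  record Prefix (rw : Word) (v k : ℕ) : Set where
    constructor prefix
    field
      worth-ʳ++ : ∀ u → worth f (rw ʳ++ u) ≡ v + 2 ^ k * worth f u

  open Prefix

  private
    unpushed : Word → Word → Word
    unpushed []      w = w
    unpushed (b ∷ u) w = true ∷ b ∷ unpushed u w

    pushBits-ʳ++ : ∀ u rw w → pushBits u rw ʳ++ w ≡ rw ʳ++ unpushed u w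
    pushBits-ʳ++ []      rw w = refl
    pushBits-ʳ++ (b ∷ u) rw w = pushBits-ʳ++ u (b ∷ true ∷ rw) w

    worthSkip-unpushed : ∀ u w → worthSkip f (unpushed u (false ∷ w)) ≡ worth f w
    worthSkip-unpushed []      w = refl
    worthSkip-unpushed (b ∷ u) w = worthSkip-unpushed u w

    worthLoad-unpushed : ∀ u r w → worthLoad f r (unpushed u (false ∷ w)) ≡ f (reverse (u ʳ++ r))
    worthLoad-unpushed []      r w = refl
    worthLoad-unpushed (b ∷ u) r w = worthLoad-unpushed u (b ∷ r) w

  prefix-[] : Prefix [] 0 0
  prefix-[] = prefix λ u → sym (+-identityʳ (worth f u))

  prefix-block : ∀ {rw v k} u → Prefix rw v k → Prefix (pushBlock u rw) (v + 2 ^ k * f u) k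
  prefix-block {rw} {v} {k} u p = prefix λ w → begin
    worth f (pushBits u (true ∷ rw) ʳ++ (false ∷ w))   ≡⟨ cong (worth f) (pushBits-ʳ++ u (true ∷ rw) (false ∷ w)) ⟩
    worth f (rw ʳ++ (true ∷ unpushed u (false ∷ w)))   ≡⟨ worth-ʳ++ p (true ∷ unpushed u (false ∷ w)) ⟩
    v + 2 ^ k * (worthSkip f (unpushed u (false ∷ w)) + worthLoad f [] (unpushed u (false ∷ w)))
      ≡⟨ cong₂ (λ s l → v + 2 ^ k * (s + l)) (worthSkip-unpushed u w)
           (trans (worthLoad-unpushed u [] w) (cong f (reverse-involutive u))) ⟩
    v + 2 ^ k * (worth f w + f u)                      ≡⟨ arith v (2 ^ k) (worth f w) (f u) ⟩
    v + 2 ^ k * f u + 2 ^ k * worth f w                ∎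
    where
    open ≡-Reasoning
    arith : ∀ v p x y → v + p * (x + y) ≡ v + p * y + p * x
    arith = solve-∀

  prefix-digits : ∀ {rw v k} ds → Prefix rw v k →
                  Prefix (pushDigits ds rw) (v + 2 ^ k * complement ds) (length ds + k)
  prefix-digits {rw} {v} {k} [] p =
    subst (λ v → Prefix rw v k) (sym (trans (cong (v +_) (*-zeroʳ (2 ^ k))) (+-identityʳ v))) p
  prefix-digits {rw} {v} {k} (d ∷ ds) p =
    subst₂ (Prefix (pushDigits ds (d ∷ false ∷ rw)))
      (arith v (2 ^ k) (bitValue (not d)) (complement ds)) (+-suc (length ds) k)
      (prefix-digits ds pushed)
    where
    arith : ∀ v p b c → v + p * b + 2 * p * c ≡ v + p * (b + (c + c))
    arith = solve-∀
    arith′ : ∀ v p b c → v + p * (c + (c + b)) ≡ v + p * b + 2 * p * c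
    arith′ = solve-∀
    pushed : Prefix (d ∷ false ∷ rw) (v + 2 ^ k * bitValue (not d)) (suc k)
    pushed = prefix λ u → trans (worth-ʳ++ p (false ∷ d ∷ u)) (arith′ v (2 ^ k) (bitValue (not d)) (worth f u))

  pushAnswer : Word → List Bool → Word → Word
  pushAnswer u ds rw = pushDigits ds (pushBlock u rw)

  -- The deficit of a block y followed by the digits of a is f y - a, made
  -- nonnegative by the complements; the first wrong answer leaves a remainder
  -- modulo a power of 2 that later answers cannot remove.

  prefix-answer : ∀ {rw v k} u ds → Prefix rw v k →
    Prefix (pushAnswer u ds rw) (v + 2 ^ k * (f u + complement ds)) (length ds + k)
  prefix-answer {rw} {v} {k} u ds p =
    subst (λ v → Prefix (pushAnswer u ds rw) v (length ds + k))
      (arith v (2 ^ k) (f u) (complement ds)) (prefix-digits ds (prefix-block u p))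
    where
    arith : ∀ v p a c → v + p * a + p * c ≡ v + p * (a + c)
    arith = solve-∀

  -- That is, `v` consists of `k` binary digits 1: no block carries into the next one, and none
  -- falls short.
  Correct : Word → Set
  Correct rw = ∃[ v ] ∃[ k ] Prefix rw v k × suc v ≡ 2 ^ k

  -- The witness `j` stays fixed after the first error while `k` grows. As `j ≤ k`, all later
  -- contributions, being multiples of `2 ^ k`, vanish modulo `2 ^ j`.
  Wrong : Word → Set
  Wrong rw = ∃[ v ] ∃[ k ] ∃[ j ] Prefix rw v k × j ≤ k × ¬ 2 ^ j ∣ suc v

  correct-[] : Correct []
  correct-[] = 0 , 0 , prefix-[] , refl

  2^-∣ : ∀ {j k} → j ≤ k → 2 ^ j ∣ 2 ^ k
  2^-∣ {j} {k} j≤k = divides (2 ^ (k ∸ j))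
    (trans (cong (2 ^_) (sym (m∸n+n≡m j≤k))) (^-distribˡ-+-* 2 (k ∸ j) j))

  private
    answered : ∀ v k u ds → suc v ≡ 2 ^ k →
               suc (v + 2 ^ k * (f u + complement ds)) ≡ 2 ^ k * suc (f u + complement ds)
    answered v k u ds eq = trans (cong (_+ 2 ^ k * (f u + complement ds)) eq)
                                     (sym (*-suc (2 ^ k) (f u + complement ds)))

  correct-answer : ∀ {rw} u ds → value ds ≡ f u → Correct rw → Correct (pushAnswer u ds rw)
  correct-answer u ds ds≡ (v , k , p , eq) = _ , _ , prefix-answer u ds p , (begin
    suc (v + 2 ^ k * (f u + complement ds)) ≡⟨ answered v k u ds eq ⟩
    2 ^ k * suc (f u + complement ds)       ≡⟨ cong (λ a → 2 ^ k * suc (a + complement ds)) ds≡ ⟨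
    2 ^ k * suc (value ds + complement ds)  ≡⟨ cong (2 ^ k *_) (value+complement ds) ⟩
    2 ^ k * 2 ^ length ds                   ≡⟨ *-comm (2 ^ k) _ ⟩
    2 ^ length ds * 2 ^ k                   ≡⟨ ^-distribˡ-+-* 2 (length ds) k ⟨
    2 ^ (length ds + k)                     ∎)
    where open ≡-Reasoning

  -- The successor of the new value is `2 ^ k * suc (f u + complement ds)`. If `2 ^ (length ds + k)`
  -- divided it, `f u` and `value ds` would agree modulo `2 ^ length ds`; both are smaller than the
  -- modulus, so they would be equal.
  wrong-answer : ∀ {rw} u ds → value ds ≢ f u → f u < 2 ^ length ds →
                 Correct rw → Wrong (pushAnswer u ds rw)
  wrong-answer u ds ds≢ fu< (v , k , p , eq) =
    _ , _ , _ , prefix-answer u ds p , ≤-refl , λ d → ds≢ (value≡ (cancel d))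
    where
    a = f u
    c = complement ds
    instance
      _ = m^n≢0 2 (length ds)
      _ = m^n≢0 2 k
    cancel : 2 ^ (length ds + k) ∣ suc (v + 2 ^ k * (a + c)) → 2 ^ length ds ∣ suc (a + c)
    cancel d = *-cancelˡ-∣ (2 ^ k)
      (subst₂ _∣_ (trans (^-distribˡ-+-* 2 (length ds) k) (*-comm _ (2 ^ k))) (answered v k u ds eq) d)
    value≡ : 2 ^ length ds ∣ suc (a + c) → value ds ≡ a
    value≡ (divides q q≡) = begin
      value ds                                 ≡⟨ m<n⇒m%n≡m (value<2^length ds) ⟨
      value ds % 2 ^ length ds                 ≡⟨ [m+kn]%n≡m%n (value ds) q (2 ^ length ds) ⟨
      (value ds + q * 2 ^ length ds) % 2 ^ length ds ≡⟨ cong (_% 2 ^ length ds) balance ⟩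
      (a + 1 * 2 ^ length ds) % 2 ^ length ds  ≡⟨ [m+kn]%n≡m%n a 1 (2 ^ length ds) ⟩
      a % 2 ^ length ds                        ≡⟨ m<n⇒m%n≡m fu< ⟩
      a                                        ∎
      where
      open ≡-Reasoning
      arith : ∀ v a c → v + suc (a + c) ≡ a + 1 * suc (v + c)
      arith = solve-∀
      balance : value ds + q * 2 ^ length ds ≡ a + 1 * 2 ^ length ds
      balance = trans (cong (value ds +_) (sym q≡))
        (trans (arith (value ds) a c) (cong (λ p → a + 1 * p) (value+complement ds)))

  still-wrong : ∀ {rw} u ds → Wrong rw → Wrong (pushAnswer u ds rw)
  still-wrong u ds (v , k , j , p , j≤k , ∤v) =
    _ , _ , j , prefix-answer u ds p , ≤-trans j≤k (m≤n+m k (length ds)) ,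
    λ d → ∤v (∣m+n∣m⇒∣n (subst (2 ^ j ∣_) (+-comm (suc v) _) d) (∣m⇒∣m*n _ (2^-∣ j≤k)))

  -- The closing digit 0 adds `2 ^ k`, one more leading 1. Without it a path that makes no query
  -- would ask for a word of worth 0, whose numeral is the digit 0 and fails the test.
  finished : Word → Word
  finished rw = rw ʳ++ (false ∷ false ∷ [])

  private
    worth-finished : ∀ {rw v k} → Prefix rw v k → worth f (finished rw) ≡ v + 2 ^ k
    worth-finished {v = v} {k} p =
      trans (worth-ʳ++ p (false ∷ false ∷ [])) (cong (v +_) (*-identityʳ (2 ^ k)))

  correct-finished : ∀ {rw} → Correct rw → and (binary (worth f (finished rw))) ≡ true
  correct-finished {rw} (v , k , p , eq) = and-binary⇐ {j = k} (begin
    suc (worth f (finished rw)) ≡⟨ cong suc (worth-finished p) ⟩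
    suc v + 2 ^ k               ≡⟨ cong (_+ 2 ^ k) eq ⟩
    2 ^ k + 2 ^ k               ≡⟨ cong (2 ^ k +_) (+-identityʳ _) ⟨
    2 ^ suc k                   ∎)
    where open ≡-Reasoning

  wrong-finished : ∀ {rw} → Wrong rw → and (binary (worth f (finished rw))) ≡ false
  wrong-finished {rw} (v , k , j , p , j≤k , ∤v) = ¬-not impossible
    where
    impossible : and (binary (worth f (finished rw))) ≢ true
    impossible ones with and-binary⇒ (worth f (finished rw)) ones
    -- `2 ^ i ≡ 2 ^ k + suc v` exceeds `2 ^ k`, so `j ≤ k < i`; then `2 ^ j` divides both powers and
    -- therefore `suc v`.
    ... | i , eq = ∤v (∣m+n∣m⇒∣n (subst (2 ^ j ∣_) total (2^-∣ (<⇒≤ (≤-<-trans j≤k k<i)))) (2^-∣ j≤k))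
      where
      total : 2 ^ i ≡ 2 ^ k + suc v
      total = trans (sym eq) (trans (cong suc (worth-finished p)) (+-comm (suc v) (2 ^ k)))
      k<i : k < i
      k<i = ≰⇒> λ i≤k → <-irrefl total (≤-<-trans (^-monoʳ-≤ 2 i≤k) (m<m+n (2 ^ k) (s≤s z≤n)))

-- Sums over guessed numerals

module Guessing (𝒦 : Counting) where
  open Counting 𝒦

  -- A sum over the `Positive` numerals of at most `m` digits, bracketed as the machine branches: a
  -- further digit 0, a further digit 1, or a 1 that ends the numeral. `answers` includes the
  -- numeral of 0, the only one with leading digit 0.
  guesses : ℕ → (List Bool → Value) → Value
  guesses zero    h = ε
  guesses (suc m) h =
    guesses m (h ∘ (false ∷_)) ∙ (guesses m (h ∘ (true ∷_)) ∙ (h [ true ] ∙ ε))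

  answers : ℕ → (List Bool → Value) → Value
  answers m h = h [ false ] ∙ (guesses m h ∙ ε)

  private
    ε∙ε∙ : ∀ {x y} z → x ≡ ε → y ≡ ε → x ∙ (y ∙ (z ∙ ε)) ≡ z
    ε∙ε∙ z refl refl = trans (identityˡ _) (trans (identityˡ _) (identityʳ z))

    ε∙ε : ∀ {x y} → x ≡ ε → y ≡ ε → x ∙ (y ∙ ε) ≡ ε
    ε∙ε refl refl = trans (identityˡ _) (identityˡ ε)

    positive-tail : ∀ {b c ds} → Positive ds → [ c ] ≢ b ∷ ds
    positive-tail () refl

  guesses-ε : ∀ m {h} → (∀ {ds} → Positive ds → h ds ≡ ε) → guesses m h ≡ ε
  guesses-ε zero    h≡ε = refl
  guesses-ε (suc m) h≡ε = trans
    (ε∙ε∙ _ (guesses-ε m (h≡ε ∘ (false ∷_))) (guesses-ε m (h≡ε ∘ (true ∷_)))) (h≡ε one)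

  -- Exactly one branch produces a given numeral, so the right answer is counted once.
  guesses-pick : ∀ m {ds h} → Positive ds → length ds ≤ m →
                 (∀ {es} → es ≢ ds → h es ≡ ε) → guesses m h ≡ h ds
  guesses-pick (suc m) one _ h≡ε =
    ε∙ε∙ _ (guesses-ε m λ _ → h≡ε λ ()) (guesses-ε m λ { one → h≡ε λ () ; (_ ∷ _) → h≡ε λ () })
  guesses-pick (suc m) {_ ∷ ds} {h} (false ∷ ps) (s≤s len) h≡ε = trans
    (cong₂ _∙_ (guesses-pick m ps len λ es≢ → h≡ε (es≢ ∘ ∷-injectiveʳ))
      (ε∙ε (guesses-ε m λ _ → h≡ε λ ()) (h≡ε λ ())))
    (identityʳ _)
  guesses-pick (suc m) (true ∷ ps) (s≤s len) h≡ε = trans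
    (cong₂ _∙_ (guesses-ε m λ _ → h≡ε λ ())
      (cong₂ _∙_ (guesses-pick m ps len λ es≢ → h≡ε (es≢ ∘ ∷-injectiveʳ))
        (trans (identityʳ _) (h≡ε (positive-tail ps)))))
    (trans (identityˡ _) (identityʳ _))

  answers-ε : ∀ m → answers m (λ _ → ε) ≡ ε
  answers-ε m = trans (identityˡ _) (trans (identityʳ _) (guesses-ε m λ _ → refl))

  answers-pick : ∀ {m n h} → n < 2 ^ m → (∀ {ds} → ds ≢ binaryLSB n → h ds ≡ ε) →
                 answers m h ≡ h (binaryLSB n)
  answers-pick {m} {zero}  n< h≡ε = trans
    (cong (_ ∙_) (trans (identityʳ _) (guesses-ε m λ { one → h≡ε λ () ; (_ ∷ ps) → h≡ε (positive-tail ps ∘ sym) })))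
    (identityʳ _)
  answers-pick {m} {suc n} n< h≡ε = trans
    (cong₂ _∙_ (h≡ε (not-zero (binaryLSB-positive n)))
      (trans (identityʳ _) (guesses-pick m (binaryLSB-positive n)
        (length-positive (binaryLSB-positive n) (subst (_< 2 ^ m) (sym (value-binaryLSB (suc n))) n<)) h≡ε)))
    (identityˡ _)
    where
    not-zero : ∀ {ds} → Positive ds → [ false ] ≢ ds
    not-zero (false ∷ ()) refl

-- The one-query machine

data Build : Set where
  goRight goLeft fetch transfer : Build

data Simulation : Set where
  simulate mendLeft mendRight copy copyBit return answerZero answer answerBit
    padding paddingBit rewindClock : Simulation

data Verdict : Set where
  finish rewindQuery ask check done failed : Verdict

finite-Build : Finite Build
finite-Build = finite-listed (goRight ∷ goLeft ∷ fetch ∷ transfer ∷ [])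
  (λ where goRight → 0F ; goLeft → 1F ; fetch → 2F ; transfer → 3F)
  (λ where goRight → refl ; goLeft → refl ; fetch → refl ; transfer → refl)

finite-Simulation : Finite Simulation
finite-Simulation = finite-listed
  (simulate ∷ mendLeft ∷ mendRight ∷ copy ∷ copyBit ∷ return ∷ answerZero ∷ answer ∷ answerBit
    ∷ padding ∷ paddingBit ∷ rewindClock ∷ [])
  (λ where simulate → 0F ; mendLeft → 1F ; mendRight → 2F ; copy → 3F ; copyBit → 4F
           return → 5F ; answerZero → 6F ; answer → 7F ; answerBit → 8F ; padding → 9F
           paddingBit → suc 9F ; rewindClock → suc (suc 9F))
  (λ where simulate → refl ; mendLeft → refl ; mendRight → refl ; copy → refl ; copyBit → refl
           return → refl ; answerZero → refl ; answer → refl ; answerBit → refl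
           padding → refl ; paddingBit → refl ; rewindClock → refl)

finite-Verdict : Finite Verdict
finite-Verdict = finite-listed (finish ∷ rewindQuery ∷ ask ∷ check ∷ done ∷ failed ∷ [])
  (λ where finish → 0F ; rewindQuery → 1F ; ask → 2F ; check → 3F ; done → 4F ; failed → 5F)
  (λ where finish → refl ; rewindQuery → refl ; ask → refl ; check → refl ; done → refl
           failed → refl)

finite-Fin : ∀ n → Finite (Fin n)
finite-Fin n = n , ↔.↔-refl

-- `rounds` selects the polynomial to which the clock is set. A sweep over an input of length n,
-- forth and back, takes 2n + 2 steps, and every round multiplies the number of marks by this. The
-- clock thus ends up with (2n + 2)^(rounds + 1) marks.
module OneQuery (𝒦 : Counting) (M : OracleMachine) (rounds : ℕ) where

  module M = OracleMachine M
  open Counting 𝒦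
  open Guessing 𝒦

  Aux = Walled M.Aux
  State = (Build × Fin (suc rounds)) ⊎ (Simulation × M.State) ⊎ (Verdict × Bool)

  pattern build p j   = inj₁ (p , j)
  pattern sim p s     = inj₂ (inj₁ (p , s))
  pattern verdict p b = inj₂ (inj₂ (p , b))

  Heads Actions : Set
  Heads   = Vec (Symbol Aux) (6 + M.extraTapes)
  Actions = Vec (Symbol Aux × Move) (6 + M.extraTapes)

  pattern mark = bit false
  pattern top  = bit true

  -- The tapes are the input, query and answer tapes, then the query and answer
  -- tapes of M, a unary clock, and the further tapes of M.  While the clock is
  -- being set, the answer tape serves as a second unary counter.

  afterRound : Fin (suc rounds) → State
  afterRound zero    = sim simulate M.start
  afterRound (suc j) = build fetch (inject₁ j)

  simulated : Heads → M.State × Vec (Symbol M.Aux × Move) (3 + M.extraTapes) → State × Actions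
  simulated (x ∷ q ∷ a ∷ y ∷ v ∷ c ∷ ws) (s , ax ∷ ay ∷ av ∷ aws) =
    sim simulate s , embedAct ax ∷ keep q ∷ keep a ∷ embedAct ay ∷ embedAct av ∷ (c , moveLeft) ∷ Vec.map embedAct aws

  -- Every simulated step uses up a mark of the clock: a run with wrong answers
  -- need not halt by itself.

  dispatch : M.State → Maybe M.State → List (M.State × Vec (Symbol M.Aux × Move) (3 + M.extraTapes)) →
             Heads → List (State × Actions)
  dispatch s (just s′) _ (x ∷ q ∷ a ∷ y ∷ v ∷ c@(bit _) ∷ ws) =
    [ sim copy s′ , keep x ∷ (bit true , moveRight) ∷ keep a ∷ keep y ∷ (wall false , moveRight) ∷ keep c ∷ Vec.map keep ws ]
  dispatch s nothing [] (x ∷ q ∷ a ∷ y ∷ v ∷ c ∷ ws) =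
    [ verdict finish (M.accepting s) , keep x ∷ (bit false , moveRight) ∷ keep a ∷ keep y ∷ keep v ∷ keep c ∷ Vec.map keep ws ]
  dispatch s nothing trs@(_ ∷ _) hs@(x ∷ q ∷ a ∷ y ∷ v ∷ c@(bit _) ∷ ws) = map (simulated hs) trs
  dispatch _ _ _ hs = [ verdict failed false , Vec.map keep hs ]

  δ : State → Heads → List (State × Actions)
  δ (build goRight j) (x@(bit _) ∷ q ∷ a ∷ y ∷ v ∷ c ∷ ws) =
    [ build goRight j , (x , moveRight) ∷ keep q ∷ (mark , moveRight) ∷ keep y ∷ keep v ∷ keep c ∷ Vec.map keep ws ]
  δ (build goRight j) (x ∷ q ∷ a ∷ y ∷ v ∷ c ∷ ws) =
    [ build goLeft j , (x , moveLeft) ∷ keep q ∷ (mark , moveRight) ∷ keep y ∷ keep v ∷ keep c ∷ Vec.map keep ws ]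
  δ (build goLeft j) (x@(bit _) ∷ q ∷ a ∷ y ∷ v ∷ c ∷ ws) =
    [ build goLeft j , (x , moveLeft) ∷ keep q ∷ (mark , moveRight) ∷ keep y ∷ keep v ∷ keep c ∷ Vec.map keep ws ]
  δ (build goLeft j) (x ∷ q ∷ a ∷ y ∷ v ∷ c ∷ ws) =
    [ build fetch j , (x , moveRight) ∷ keep q ∷ (mark , moveRight) ∷ keep y ∷ keep v ∷ keep c ∷ Vec.map keep ws ]
  δ (build fetch j) (x ∷ q ∷ a ∷ y ∷ v ∷ c@(bit _) ∷ ws) =
    [ build goRight j , keep x ∷ keep q ∷ keep a ∷ keep y ∷ keep v ∷ (c , moveLeft) ∷ Vec.map keep ws ]
  δ (build fetch j) (x ∷ q ∷ a ∷ y ∷ v ∷ c ∷ ws) =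
    [ build transfer j , keep x ∷ keep q ∷ (a , moveLeft) ∷ keep y ∷ keep v ∷ (c , moveRight) ∷ Vec.map keep ws ]
  δ (build transfer j) (x ∷ q ∷ a@(bit _) ∷ y ∷ v ∷ c ∷ ws) =
    [ build transfer j , keep x ∷ keep q ∷ (a , moveLeft) ∷ keep y ∷ keep v ∷ (mark , moveRight) ∷ Vec.map keep ws ]
  δ (build transfer j) (x ∷ q ∷ a ∷ y ∷ v ∷ c ∷ ws) =
    [ afterRound j , keep x ∷ keep q ∷ keep a ∷ keep y ∷ keep v ∷ (c , moveLeft) ∷ Vec.map keep ws ]
  δ (sim simulate s) (x ∷ q ∷ a ∷ y ∷ aux (inj₂ false) ∷ c ∷ ws) =
    [ sim mendLeft s , keep x ∷ keep q ∷ keep a ∷ keep y ∷ (blank , moveLeft) ∷ keep c ∷ Vec.map keep ws ]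
  δ (sim simulate s) (x ∷ q ∷ a ∷ y ∷ aux (inj₂ true) ∷ c ∷ ws) =
    [ sim mendRight s , keep x ∷ keep q ∷ keep a ∷ keep y ∷ (blank , moveRight) ∷ keep c ∷ Vec.map keep ws ]
  δ (sim simulate s) hs@(x ∷ q ∷ a ∷ y ∷ v ∷ c ∷ ws) =
    dispatch s (M.resume s) (M.δ s (unembed x ∷ unembed y ∷ unembed v ∷ Vec.map unembed ws)) hs
  δ (sim mendLeft s) (x ∷ q ∷ a ∷ y ∷ v ∷ c ∷ ws) =
    [ sim simulate s , keep x ∷ keep q ∷ keep a ∷ keep y ∷ (wall false , moveRight) ∷ keep c ∷ Vec.map keep ws ]
  δ (sim mendRight s) (x ∷ q ∷ a ∷ y ∷ v ∷ c ∷ ws) =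
    [ sim simulate s , keep x ∷ keep q ∷ keep a ∷ keep y ∷ (wall true , moveLeft) ∷ keep c ∷ Vec.map keep ws ]
  δ (sim copy s) (x ∷ q ∷ a ∷ y@(bit _) ∷ v ∷ c ∷ ws) =
    [ sim copyBit s , keep x ∷ (bit true , moveRight) ∷ keep a ∷ keep y ∷ keep v ∷ keep c ∷ Vec.map keep ws ]
  δ (sim copy s) (x ∷ q ∷ a ∷ y ∷ v ∷ c ∷ ws) =
    [ sim return s , keep x ∷ (bit false , moveRight) ∷ keep a ∷ keep y ∷ (v , moveLeft) ∷ keep c ∷ Vec.map keep ws ]
  -- Every copied bit leaves a wall on the simulated answer tape, which so counts how far the head
  -- of the simulated query tape has to return. That tape may also hold bits before the query, so
  -- its own cells cannot tell.
  δ (sim copyBit s) (x ∷ q ∷ a ∷ y ∷ v ∷ c ∷ ws) =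
    [ sim copy s , keep x ∷ (y , moveRight) ∷ keep a ∷ (y , moveRight) ∷ (wall true , moveRight) ∷ keep c ∷ Vec.map keep ws ]
  δ (sim return s) (x ∷ q ∷ a ∷ y ∷ v@(aux (inj₂ true)) ∷ c ∷ ws) =
    [ sim return s , keep x ∷ keep q ∷ keep a ∷ (y , moveLeft) ∷ (v , moveLeft) ∷ keep c ∷ Vec.map keep ws ]
  -- The bottom of the counter becomes the right wall of the answer, which is written leftwards from
  -- here. `top` takes the place of the mark spent on this call and shows where rewinding the clock
  -- has to stop.
  δ (sim return s) (x ∷ q ∷ a ∷ y ∷ v ∷ c ∷ ws) =
    map (λ p → sim p s , keep x ∷ keep q ∷ keep a ∷ keep y ∷ (wall true , moveLeft) ∷ (top , moveLeft) ∷ Vec.map keep ws)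
        (answerZero ∷ answer ∷ [])
  δ (sim answerZero s) (x ∷ q ∷ a ∷ y ∷ v ∷ c ∷ ws) =
    [ sim padding s , keep x ∷ keep q ∷ keep a ∷ keep y ∷ (bit false , moveLeft) ∷ keep c ∷ Vec.map keep ws ]
  δ (sim answer s) (x ∷ q ∷ a ∷ y ∷ v ∷ c@(bit _) ∷ ws) =
    [ sim answerBit s , keep x ∷ (bit false , moveRight) ∷ keep a ∷ keep y ∷ keep v ∷ keep c ∷ Vec.map keep ws ]
  δ (sim answer s) hs = [ verdict failed false , Vec.map keep hs ]
  δ (sim answerBit s) (x ∷ q ∷ a ∷ y ∷ v ∷ c ∷ ws) =
    map (λ (p , b) → sim p s , keep x ∷ (bit b , moveRight) ∷ keep a ∷ keep y ∷ (bit b , moveLeft) ∷ (c , moveLeft) ∷ Vec.map keep ws)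
        -- Only a digit 1 may end the numeral, as the digits come least significant first.
        ((answer , false) ∷ (answer , true) ∷ (padding , true) ∷ [])
  -- Digits and padding together pass each remaining mark once, so every answer is recorded with as
  -- many digits as the clock has marks left.
  δ (sim padding s) (x ∷ q ∷ a ∷ y ∷ v ∷ c@(bit _) ∷ ws) =
    [ sim paddingBit s , keep x ∷ (bit false , moveRight) ∷ keep a ∷ keep y ∷ keep v ∷ keep c ∷ Vec.map keep ws ]
  δ (sim padding s) (x ∷ q ∷ a ∷ y ∷ v ∷ c ∷ ws) =
    [ sim rewindClock s , keep x ∷ keep q ∷ keep a ∷ keep y ∷ (wall false , moveRight) ∷ (c , moveRight) ∷ Vec.map keep ws ]
  δ (sim paddingBit s) (x ∷ q ∷ a ∷ y ∷ v ∷ c ∷ ws) =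
    [ sim padding s , keep x ∷ (bit false , moveRight) ∷ keep a ∷ keep y ∷ keep v ∷ (c , moveLeft) ∷ Vec.map keep ws ]
  δ (sim rewindClock s) (x ∷ q ∷ a ∷ y ∷ v ∷ top ∷ ws) =
    [ sim simulate s , keep x ∷ keep q ∷ keep a ∷ keep y ∷ keep v ∷ (mark , moveLeft) ∷ Vec.map keep ws ]
  δ (sim rewindClock s) (x ∷ q ∷ a ∷ y ∷ v ∷ c ∷ ws) =
    [ sim rewindClock s , keep x ∷ keep q ∷ keep a ∷ keep y ∷ keep v ∷ (c , moveRight) ∷ Vec.map keep ws ]
  δ (verdict finish b) (x ∷ q ∷ a ∷ y ∷ v ∷ c ∷ ws) =
    [ verdict rewindQuery b , keep x ∷ (bit false , moveLeft) ∷ keep a ∷ keep y ∷ keep v ∷ keep c ∷ Vec.map keep ws ]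
  δ (verdict rewindQuery b) (x ∷ q@(bit _) ∷ a ∷ y ∷ v ∷ c ∷ ws) =
    [ verdict rewindQuery b , keep x ∷ (q , moveLeft) ∷ keep a ∷ keep y ∷ keep v ∷ keep c ∷ Vec.map keep ws ]
  δ (verdict rewindQuery b) (x ∷ q ∷ a ∷ y ∷ v ∷ c ∷ ws) =
    [ verdict ask b , keep x ∷ (q , moveRight) ∷ keep a ∷ keep y ∷ keep v ∷ keep c ∷ Vec.map keep ws ]
  δ (verdict ask b) _ = []
  δ (verdict check b) (x ∷ q ∷ a@(bit true) ∷ y ∷ v ∷ c ∷ ws) =
    [ verdict check b , keep x ∷ keep q ∷ (a , moveRight) ∷ keep y ∷ keep v ∷ keep c ∷ Vec.map keep ws ]
  δ (verdict check b) hs@(x ∷ q ∷ blank ∷ y ∷ v ∷ c ∷ ws) = [ verdict done b , Vec.map keep hs ]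
  δ (verdict check b) hs = [ verdict failed false , Vec.map keep hs ]
  δ (verdict done b) _ = []
  δ (verdict failed _) hs = map (λ b → verdict done b , Vec.map keep hs) void

  resume : State → Maybe State
  resume (verdict ask b) = just (verdict check b)
  resume _               = nothing

  machine : OracleMachine
  machine = record
    { extraTapes = 3 + M.extraTapes
    ; machine = record
      { State = State ; Aux = Aux
      ; finite-State = finite-⊎ (finite-× finite-Build (finite-Fin (suc rounds)))
          (finite-⊎ (finite-× finite-Simulation M.finite-State) (finite-× finite-Verdict finite-Bool))
      ; finite-Aux = finite-⊎ M.finite-Aux finite-Bool
      ; start = build goRight (fromℕ rounds)
      ; accepting = λ { (verdict done b) → b ; _ → false }
      ; δ = δ
      }
    ; resume = resume
    }

-- Words on tapes and their reversals

module _ {A : Set} where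

  ʳ++-bits : ∀ u {l : List (Symbol A)} → map bit u ʳ++ l ≡ map bit (reverse u) ++ l
  ʳ++-bits u {l} = trans (ʳ++-defn (map bit u)) (cong (_++ l) (sym (reverse-map bit u)))

  bits-ʳ++ : ∀ u {l : List (Symbol A)} → map bit (reverse u) ʳ++ l ≡ map bit u ++ l
  bits-ʳ++ u {l} = trans (ʳ++-bits (reverse u)) (cong (λ u → map bit u ++ l) (reverse-involutive u))

  blankEnd : List (Symbol A) → List (Symbol A)
  blankEnd []      = [ blank ]
  blankEnd (s ∷ r) = s ∷ r

  at-blankEnd : ∀ l r → at l r ≡ at l (blankEnd r)
  at-blankEnd l []      = refl
  at-blankEnd l (_ ∷ _) = refl

  moveLeft-at : ∀ s l r → act (head (at (s ∷ l) r) , moveLeft) (at (s ∷ l) r) ≡ at l (s ∷ blankEnd r)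
  moveLeft-at s l []      = refl
  moveLeft-at s l (_ ∷ _) = refl

  readWord-at : ∀ l u → readWord {A} (at l (map bit u)) ≡ u
  readWord-at l []      = refl
  readWord-at l (b ∷ u) = bitPrefix-map (b ∷ u)

  bitPrefix-split : ∀ (cs : List (Symbol A)) →
    ∃[ zs ] cs ≡ map bit (bitPrefix cs) ++ zs × bitPrefix zs ≡ []
  bitPrefix-split []           = [] , refl , refl
  bitPrefix-split (blank ∷ cs) = blank ∷ cs , refl , refl
  bitPrefix-split (aux x ∷ cs) = aux x ∷ cs , refl , refl
  bitPrefix-split (bit b ∷ cs) with bitPrefix-split cs
  ... | zs , eq , none = zs , cong (bit b ∷_) eq , none

module _ {A : Set} where

  side-blank : ∀ {cs : List (Symbol A)} {cs′} → Side nothing cs cs′ → Side nothing cs (cs′ ++ [ blank ])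
  side-blank fresh      = padded fresh
  side-blank (padded s) = padded (side-blank s)
  side-blank (s ∷ ss)   = s ∷ side-blank ss

  side-blankEnd : ∀ {cs : List (Symbol A)} {cs′} u zs → cs′ ≡ map bit u ++ zs →
                  Side nothing cs cs′ → Side nothing cs (map bit u ++ blankEnd zs)
  side-blankEnd u []      refl s = subst (Side nothing _) (++-[]-blank u) (side-blank s)
    where
    ++-[]-blank : ∀ u → (map bit u ++ []) ++ [ blank ] ≡ map bit u ++ [ blank ]
    ++-[]-blank []      = refl
    ++-[]-blank (b ∷ u) = cong (bit b ∷_) (++-[]-blank u)
  side-blankEnd u (_ ∷ _) refl s = s

  represents-at : ∀ {t : Tape A} {l cs} → Side nothing (left t) l → Side nothing (head t ∷ right t) cs →
                  Represents nothing nothing t (at l cs)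
  represents-at sl (_ ∷ sr) = rep sl sr

  represents-word : ∀ {w g} {V : Tape (Walled A)} → 1 ≤ length w → right V ≡ map bit w ++ wall true ∷ g →
    Represents (just false) (just true) (writeWord w) (act (wall false , moveRight) V)
  represents-word {b ∷ w} {V = tape l h _} _ refl = rep (walled refl) (side-++ w (walled refl))

-- Runs of the one-query machine

module Correctness (𝒦 : Counting) (M : OracleMachine) (rounds : ℕ) (f : Word → ℕ) where

  open OneQuery 𝒦 M rounds
  open Counting 𝒦
  open Guessing 𝒦

  system : System
  system = machine withOracle (worth f)

  open System system using (Config; step; querying)
  open Runs 𝒦 system

  config : State → (X Q A Y V C : Tape Aux) → Vec (Tape Aux) M.extraTapes → Config
  config s X Q A Y V C W = s , X ∷ Q ∷ A ∷ Y ∷ V ∷ C ∷ W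

  written : Word → Tape Aux
  written rw = tape (map bit rw) blank []

  -- The clock with k marks left, its head having just left a cell with s.

  clock : ℕ → Symbol Aux → List (Symbol Aux) → Tape Aux
  clock k s g = move moveLeft (tape (replicate k mark ++ [ blank ]) s g)

  private
    variable
      s s′ : State
      X Q A Y V C X′ Q′ A′ Y′ V′ C′ : Tape Aux
      W : Vec (Tape Aux) M.extraTapes
      t q : ℕ
      v : Value

  one-step : step (config s X Q A Y V C W) ≡
               [ config s′ X′ Q′ A′ Y′ V′ C′ (zipWith act (Vec.map keep (Vec.map head W)) W) ] →
             querying (config s X Q A Y V C W) ≡ false →
             Run t q (config s′ X′ Q′ A′ Y′ V′ C′ W) v →
             Run (suc t) q (config s X Q A Y V C W) v
  one-step {W = W} {q = q} eq eq′ run =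
    run₁ (trans eq (cong (λ W → [ _ , _ ∷ _ ∷ _ ∷ _ ∷ _ ∷ _ ∷ W ]) (keep-all W)))
         (≤-reflexive (cong (λ b → (if b then 1 else 0) + q) eq′)) run

  done-run : ∀ b {ts} → Run t q (verdict done b , ts) (weight b)
  done-run b = halt refl z≤n

  -- With an empty `void` the state `failed` would itself halt and be weighed as a rejection, which
  -- in the case of gaps is not worth nothing; hence the appeal to `void-nonempty`.
  failed-run : ∀ {b} → Run (suc t) q (config (verdict failed b) X Q A Y V C W) ε
  failed-run {t} {q} {X} {Q} {A} {Y} {V} {C} {W} {b} =
    subst (Run (suc t) q (verdict failed b , ts)) void-total (go-all (nonempty void void-nonempty) ≤-refl (outcomes void))
    where
    ts = X ∷ Q ∷ A ∷ Y ∷ V ∷ C ∷ W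
    leave : Bool → State × Actions
    leave b = verdict done b , Vec.map keep (Vec.map head ts)
    nonempty : ∀ bs → null bs ≡ false → null (map (perform ts) (map leave bs)) ≡ false
    nonempty (_ ∷ _) _ = refl
    outcomes : ∀ bs → Runs t q (map (perform ts) (map leave bs)) (total (map weight bs))
    outcomes []       = []
    outcomes (b ∷ bs) = done-run b ∷ outcomes bs

  -- Setting the clock

  -- Like most lemmas on phases below, this turns a run from the exit of a phase into one from its
  -- entry. The exit is quantified over all counters with the stated left part, because what lies
  -- right of the counter's head does not influence the machine.
  goRight-run : ∀ {j} u {l r d} → (∀ l → at l r ≡ tape l blank []) → left A ≡ replicate d mark →
    (∀ {A} → left A ≡ replicate (suc (length u) + d) mark →
       Run t q (config (build goLeft j) (move moveLeft (tape (map bit u ʳ++ l) blank [])) Q A Y V C W) v) →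
    Run (suc (length u) + t) q (config (build goRight j) (at l (map bit u ++ r)) Q A Y V C W) v
  goRight-run {A = A} [] {l} at-r A≡ k rewrite at-r l =
    one-step refl refl (k (trans (left-moveRight (record A { head = mark })) (cong (mark ∷_) A≡)))
  goRight-run {A = A} (b ∷ u) {l} {r} {d} at-r A≡ k =
    one-step refl refl
      (subst (λ X → Run _ _ (config _ X _ _ _ _ _ _) _) (sym (moveRight-at l (bit b) (map bit u ++ r)))
        (goRight-run u at-r (trans (left-moveRight (record A { head = mark })) (cong (mark ∷_) A≡))
          λ {A} A≡ → k {A} (trans A≡ (cong (λ n → replicate n mark) (+-suc (suc (length u)) d)))))

  goLeft-run : ∀ {j} u {l h r d} → (∀ h r → move moveLeft (tape l h r) ≡ tape [] blank (h ∷ r)) →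
    left A ≡ replicate d mark →
    (∀ {A} → left A ≡ replicate (suc (length u) + d) mark →
       Run t q (config (build fetch j) (at [ blank ] (map bit u ʳ++ (h ∷ r))) Q A Y V C W) v) →
    Run (suc (length u) + t) q (config (build goLeft j) (move moveLeft (tape (map bit u ++ l) h r)) Q A Y V C W) v
  goLeft-run {A = A} [] {l} {h} {r} at-l A≡ k rewrite at-l h r =
    one-step refl refl (k (trans (left-moveRight (record A { head = mark })) (cong (mark ∷_) A≡)))
  goLeft-run {A = A} (b ∷ u) {l} {h} {r} {d} at-l A≡ k =
    one-step refl refl
      (goLeft-run u at-l (trans (left-moveRight (record A { head = mark })) (cong (mark ∷_) A≡))
        λ {A} A≡ → k {A} (trans A≡ (cong (λ n → replicate n mark) (+-suc (suc (length u)) d))))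

  sweep : ℕ → ℕ
  sweep n = suc n + suc n

  -- The hypotheses on `l` and `r` cover both a fresh input tape, with no cells listed beyond the
  -- word, and a swept one, with a blank at either end.
  sweep-run : ∀ {j} x {l r d} → (∀ l → at l r ≡ tape l blank []) →
    (∀ h r → move moveLeft (tape l h r) ≡ tape [] blank (h ∷ r)) → left A ≡ replicate d mark →
    (∀ {A} → left A ≡ replicate (sweep (length x) + d) mark →
       Run t q (config (build fetch j) (swept x) Q A Y V C W) v) →
    Run (sweep (length x) + t) q (config (build goRight j) (at l (map bit x ++ r)) Q A Y V C W) v
  sweep-run {t = t} {q} {Q = Q} {Y} {V} {C} {W} {v} {j} x {l} {r} {d} at-r at-l A≡ k =
    weaken (≤-reflexive (trans (cong (λ n → suc (length x) + (suc n + t)) (length-reverse x))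
                               (sym (+-assoc (suc (length x)) (suc (length x)) t))))
      (goRight-run x at-r A≡ λ {A} A≡ →
        subst (λ ss → Run (suc (length (reverse x)) + t) q (config (build goLeft j) (move moveLeft (tape ss blank [])) Q A Y V C W) v) (sym (ʳ++-bits x))
          (goLeft-run (reverse x) at-l A≡ λ {A} A≡ →
            subst (λ ss → Run t q (config (build fetch j) (at [ blank ] ss) Q A Y V C W) v) (sym (bits-ʳ++ x))
              (k (trans A≡ (cong (λ n → replicate n mark)
                (trans (cong (λ n → suc n + (suc (length x) + d)) (length-reverse x))
                       (sym (+-assoc (suc (length x)) (suc (length x)) d))))))))

  emptied-run : ∀ {j g} → (∀ {C} → left C ≡ [ blank ] → Run t q (config (build transfer j) X Q (move moveLeft A) Y V C W) v) →
    Run (suc t) q (config (build fetch j) X Q A Y V (tape [] blank g) W) v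
  emptied-run {g = g} k = one-step refl refl (k (left-moveRight (tape [] blank g)))

  -- This is the multiplication: each of the `c` marks of the clock pays for one sweep.
  fetch-run : ∀ {j} x c {d s g} → left A ≡ replicate d mark →
    (∀ {A C} → left A ≡ replicate (c * sweep (length x) + d) mark → left C ≡ [ blank ] →
       Run t q (config (build transfer j) (swept x) Q (move moveLeft A) Y V C W) v) →
    Run (c * suc (sweep (length x)) + suc t) q (config (build fetch j) (swept x) Q A Y V (clock c s g) W) v
  fetch-run x zero A≡ k = emptied-run λ C≡ → k A≡ C≡
  fetch-run {t = t} {q} {Q} {Y} {V} {W} {v} {j} x (suc c) {d} {s} {g} A≡ k =
    one-step refl refl (weaken (≤-reflexive (sym (+-assoc (sweep (length x)) (c * suc (sweep (length x))) (suc t))))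
      (sweep-run x (λ _ → refl) (λ _ _ → refl) A≡ λ A≡ →
        fetch-run x c A≡ λ A≡ C≡ →
          k (trans A≡ (cong (λ n → replicate n mark) (arith c (sweep (length x)) d))) C≡))
    where
    arith : ∀ c m d → c * m + (m + d) ≡ suc c * m + d
    arith = solve-∀

  transfer-run : ∀ {j} d {h r i} → left C ≡ replicate i mark ++ [ blank ] →
    (∀ {A s g} → left A ≡ [] → Run t q (config (afterRound j) X Q A Y V (clock (d + i) s g) W) v) →
    Run (suc d + t) q (config (build transfer j) X Q (move moveLeft (tape (replicate d mark) h r)) Y V C W) v
  transfer-run {C = C} {t = t} {q} {X} {Q} {Y} {V} {W} {v} {j} zero {h} {r} C≡ k =
    one-step refl refl
      (subst (λ l → Run t q (config (afterRound j) X Q (tape [] blank (h ∷ r)) Y V (move moveLeft (tape l (head C) (right C))) W) v)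
        (sym C≡) (k refl))
  transfer-run {C = C} {t = t} {q} {X} {Q} {Y} {V} {W} {v} {j} (suc d) {i = i} C≡ k =
    one-step refl refl (transfer-run d {i = suc i}
      (trans (left-moveRight (record C { head = mark })) (cong (mark ∷_) C≡))
      λ {A} {s} {g} A≡ →
        subst (λ n → Run t q (config (afterRound j) X Q A Y V (clock n s g) W) v) (sym (+-suc d i)) (k A≡))

  -- Equal to `d * sweep n ^ k`, in the accumulating form in which the rounds produce it.
  marks : ℕ → ℕ → ℕ → ℕ
  marks n zero    d = d
  marks n (suc k) d = marks n k (d * sweep n)

  rounds-time : ℕ → ℕ → ℕ → ℕ
  rounds-time n zero    d = suc d
  rounds-time n (suc k) d = suc d + (d * suc (sweep n) + suc (rounds-time n k (d * sweep n)))

  rounds-run : ∀ k {j} x {d} → toℕ j ≡ k → left C ≡ [ blank ] → left A ≡ replicate d mark →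
    (∀ {A s g} → Run t q (config (sim simulate M.start) (swept x) Q A Y V (clock (marks (length x) k d) s g) W) v) →
    Run (rounds-time (length x) k d + t) q (config (build transfer j) (swept x) Q (move moveLeft A) Y V C W) v
  rounds-run {C = C} {A = A} {t = t} {q} {Q} {Y} {V} {W} {v} zero {zero} x {d} _ C≡ A≡ k =
    subst (λ l → Run (suc d + t) q (config (build transfer zero) (swept x) Q (move moveLeft (tape l (head A) (right A))) Y V C W) v) (sym A≡)
      (transfer-run d {i = 0} C≡ λ {A} {s} {g} _ →
        subst (λ n → Run t q (config (sim simulate M.start) (swept x) Q A Y V (clock n s g) W) v) (sym (+-identityʳ d)) k)
  rounds-run {C = C} {A = A} {t = t} {q} {Q} {Y} {V} {W} {v} (suc i) {suc j} x {d} j≡ C≡ A≡ k =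
    subst (λ l → Run (rounds-time n (suc i) d + t) q (config (build transfer (suc j)) (swept x) Q (move moveLeft (tape l (head A) (right A))) Y V C W) v) (sym A≡)
      (weaken (≤-reflexive (arith (suc d) (d * suc (sweep n)) (rounds-time n i (d * sweep n)) t))
        (transfer-run d {i = 0} C≡ λ {A} {s} {g} A≡ →
          subst (λ c → Run (d * suc (sweep n) + suc (rounds-time n i (d * sweep n) + t)) q
                          (config (build fetch (inject₁ j)) (swept x) Q A Y V (clock c s g) W) v) (sym (+-identityʳ d))
            (fetch-run x d {d = 0} A≡ λ {A} {C} A≡ C≡ →
              rounds-run i x (trans (toℕ-inject₁ j) (suc-injective j≡)) C≡
                (trans A≡ (cong (λ n → replicate n mark) (+-identityʳ (d * sweep n)))) k)))
    where
    n = length x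
    arith : ∀ a b c t → a + (b + suc (c + t)) ≡ (a + (b + suc c)) + t
    arith = solve-∀

  build-time : ℕ → ℕ
  build-time n = sweep n + suc (rounds-time n rounds (sweep n))

  initial-marks : ℕ → ℕ
  initial-marks n = marks n rounds (sweep n)

  build-run : ∀ x →
    (∀ {A s g} → Run t q (config (sim simulate M.start) (swept x) emptyTape A emptyTape emptyTape
                                 (clock (initial-marks (length x)) s g) (Vec.replicate M.extraTapes emptyTape)) v) →
    Run (build-time (length x) + t) q (System.initial system x) v
  build-run {t} {q} {v} x k =
    weaken (≤-reflexive (arith (sweep n) (rounds-time n rounds (sweep n)) t))
      (subst (λ X → Run (sweep n + suc (rounds-time n rounds (sweep n) + t)) q
                        (config (build goRight (fromℕ rounds)) X emptyTape emptyTape emptyTape emptyTape emptyTape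
                                (Vec.replicate M.extraTapes emptyTape)) v)
        (trans (cong (at []) (++-identityʳ (map bit x))) (sym (at-writeWord x)))
        (sweep-run x {r = []} {d = 0} (λ _ → refl) (λ _ _ → refl) refl λ A≡ →
          emptied-run λ C≡ →
            rounds-run rounds x (toℕ-fromℕ rounds) C≡
              (trans A≡ (cong (λ n → replicate n mark) (+-identityʳ (sweep n)))) k))
    where
    n = length x
    arith : ∀ a b t → a + suc (b + t) ≡ (a + suc b) + t
    arith = solve-∀

-- A simulated query, and the final check

module Queries (𝒦 : Counting) (M : OracleMachine) (rounds : ℕ) (f : Word → ℕ) where

  open OneQuery 𝒦 M rounds
  open Correctness 𝒦 M rounds f
  open Counting 𝒦
  open Guessing 𝒦
  open Ledger f
  open System system using (Config; step; querying)
  open Runs 𝒦 system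

  private
    variable
      s : M.State
      X Q A Y V C : Tape Aux
      W : Vec (Tape Aux) M.extraTapes
      t q : ℕ
      v : Value

  -- A wall met by the head is replaced by a blank and set up again one cell further out, on top of
  -- garbage, which takes two steps.
  mend-run : ∀ {V₀} → Reaches (just false) (just true) V₀ V →
    (∀ {V} → Represents (just false) (just true) V₀ V → Run t q (config (sim simulate s) X Q A Y V C W) v) →
    Run (2 + t) q (config (sim simulate s) X Q A Y V C W) v
  mend-run (inside r) k = weaken (m≤n+m _ 2) (k r)
  mend-run (atLeft {g = []} refl sr) k =
    one-step refl refl (one-step refl refl (k (rep (walled refl) sr)))
  mend-run (atLeft {g = _ ∷ _} refl sr) k =
    one-step refl refl (one-step refl refl (k (rep (walled refl) sr)))
  mend-run (atRight {g = []} refl sl) k =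
    one-step refl refl (one-step refl refl (k (rep sl (walled refl))))
  mend-run (atRight {g = _ ∷ _} refl sl) k =
    one-step refl refl (one-step refl refl (k (rep sl (walled refl))))

  walls : ℕ → List (Symbol Aux) → List (Symbol Aux)
  walls i l = replicate i (wall true) ++ wall false ∷ l

  copy-run : ∀ u {zs l lv rw i} → bitPrefix zs ≡ [] → left V ≡ walls i lv →
    (∀ {V} → left V ≡ walls (length u + i) lv →
       Run t q (config (sim return s) X (written (false ∷ pushBits u rw)) A (at (map bit u ʳ++ l) zs) (move moveLeft V) C W) v) →
    Run (suc (2 * length u) + t) q (config (sim copy s) X (written rw) A (at l (map bit u ++ zs)) V C W) v
  copy-run [] {[]}        none V≡ k = one-step refl refl (k V≡)
  copy-run [] {blank ∷ _} none V≡ k = one-step refl refl (k V≡)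
  copy-run [] {aux _ ∷ _} none V≡ k = one-step refl refl (k V≡)
  copy-run [] {bit _ ∷ _} ()   V≡ k
  copy-run {V = V} {t = t} {q} {s} {X} {A} {C} {W} {v} (b ∷ u) {zs} {l} {lv} {rw} {i} none V≡ k =
    weaken (≤-reflexive (arith (length u) t))
      (one-step refl refl (one-step refl refl
        (subst (λ Y → Run (suc (2 * length u) + t) q
                        (config (sim copy s) X (written (b ∷ true ∷ rw)) A Y (act (wall true , moveRight) V) C W) v)
          (sym (moveRight-at l (bit b) (map bit u ++ zs)))
          (copy-run u {i = suc i} none
            (trans (left-moveRight (record V { head = wall true })) (cong (wall true ∷_) V≡))
            λ {V} V≡ → k {V} (trans V≡ (cong (λ n → walls n lv) (+-suc (length u) i)))))))
    where
    arith : ∀ m t → 2 + (suc (2 * m) + t) ≡ suc (2 * suc m) + t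
    arith = solve-∀

  return-run : ∀ ru {zs l lv h r m c g₀ w} →
    (∀ {V g} → right V ≡ wall true ∷ g →
      Run t q (config (sim answerZero s) X Q A (at l (map bit ru ʳ++ blankEnd zs)) V (clock m top g₀) W) v) →
    (∀ {V g} → right V ≡ wall true ∷ g →
      Run t q (config (sim answer s) X Q A (at l (map bit ru ʳ++ blankEnd zs)) V (clock m top g₀) W) w) →
    Run (suc (length ru) + t) q
      (config (sim return s) X Q A (at (map bit ru ++ l) zs) (move moveLeft (tape (walls (length ru) lv) h r))
              (tape (replicate m mark ++ [ blank ]) c g₀) W) (v ∙ (w ∙ ε))
  return-run {t} {q} {s} {X} {Q} {A} {W} {v} [] {zs} {l} {lv} {h} {r} {m} {c} {g₀} {w} kz kp =
    go (cong (λ W → config (sim answerZero s) X Q A (at l zs) V′ (clock m top g₀) W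
                    ∷ config (sim answer s) X Q A (at l zs) V′ (clock m top g₀) W ∷ []) (keep-all W))
       ≤-refl (zero-run ∷ positive-run ∷ [])
    where
    V′ : Tape Aux
    V′ = move moveLeft (tape lv (wall true) (h ∷ r))
    zero-run : Run t q (config (sim answerZero s) X Q A (at l zs) V′ (clock m top g₀) W) v
    zero-run rewrite at-blankEnd l zs = kz (right-moveLeft (tape lv (wall true) (h ∷ r)))
    positive-run : Run t q (config (sim answer s) X Q A (at l zs) V′ (clock m top g₀) W) w
    positive-run rewrite at-blankEnd l zs = kp (right-moveLeft (tape lv (wall true) (h ∷ r)))
  return-run {t} {q} {s} {X} {Q} {A} {W} {v} (b ∷ ru) {zs} {l} {lv} {h} {r} {m} {c} {g₀} {w} kz kp =
    one-step refl refl
      (subst (λ Y → Run (suc (length ru) + t) q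
                (config (sim return s) X Q A Y (move moveLeft (tape (walls (length ru) lv) (wall true) (h ∷ r)))
                        (tape (replicate m mark ++ [ blank ]) c g₀) W) (v ∙ (w ∙ ε)))
        (sym (moveLeft-at (bit b) (map bit ru ++ l) zs))
        (return-run ru {zs = bit b ∷ blankEnd zs} kz kp))

  -- The guessed digits go to two places: in the order of guessing to the query word, and leftwards
  -- onto the simulated answer tape, where they then read most significant first, as `binary`
  -- demands. An exhausted clock corresponds to the empty sum.
  answer-run : ∀ k (h : List Bool → Value) {rw ds′ i c g g₀ gv} →
    c ∷ g ≡ replicate i mark ++ top ∷ g₀ → right V ≡ map bit ds′ ++ wall true ∷ gv →
    (∀ {ds j V c g} → Positive ds → length ds + j ≡ k →
       c ∷ g ≡ replicate (length ds + i) mark ++ top ∷ g₀ → right V ≡ map bit (ds ʳ++ ds′) ++ wall true ∷ gv →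
       Run t q (config (sim padding s) X (written (pushDigits ds rw)) A Y V (clock j c g) W) (h ds)) →
    Run (suc (2 * k) + suc t) q (config (sim answer s) X (written rw) A Y V (clock k c g) W) (guesses k h)
  answer-run zero    h C≡ V≡ leaf = one-step refl refl failed-run
  answer-run {V} {t} {q} {s} {X} {A} {Y} {W} (suc k) h {rw} {ds′} {i} {c} {g} {g₀} {gv} C≡ V≡ leaf =
    weaken (≤-reflexive (arith k t))
      (one-step refl refl
        (go (cong (λ W → branch W answer false ∷ branch W answer true ∷ branch W padding true ∷ []) (keep-all W))
            ≤-refl
          (answer-run k (h ∘ (false ∷_)) C≡′ (V≡′ false) (leaf′ false) ∷
           answer-run k (h ∘ (true ∷_)) C≡′ (V≡′ true) (leaf′ true) ∷
           weaken (≤-trans (n≤1+n t) (m≤n+m (suc t) (suc (2 * k)))) (leaf one refl C≡′ (V≡′ true)) ∷ [])))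
    where
    arith : ∀ k t → suc (suc (suc (2 * k) + suc t)) ≡ suc (2 * suc k) + suc t
    arith = solve-∀
    branch : Vec (Tape Aux) M.extraTapes → Simulation → Bool → Config
    branch W p b = config (sim p s) X (written (b ∷ false ∷ rw)) A Y (act (bit b , moveLeft) V) (clock k mark (c ∷ g)) W
    C≡′ : mark ∷ c ∷ g ≡ replicate (suc i) mark ++ top ∷ g₀
    C≡′ = cong (mark ∷_) C≡
    V≡′ : ∀ b → right (act (bit b , moveLeft) V) ≡ map bit (b ∷ ds′) ++ wall true ∷ gv
    V≡′ b = trans (right-moveLeft (record V { head = bit b })) (cong (bit b ∷_) V≡)
    leaf′ : ∀ b {ds j V c g} → Positive ds → length ds + j ≡ k →
       c ∷ g ≡ replicate (length ds + suc i) mark ++ top ∷ g₀ → right V ≡ map bit (ds ʳ++ (b ∷ ds′)) ++ wall true ∷ gv →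
       Run t q (config (sim padding s) X (written (pushDigits ds (b ∷ false ∷ rw))) A Y V (clock j c g) W) (h (b ∷ ds))
    leaf′ b {ds} {V = V} ps len C≡ V≡ =
      leaf (b ∷ ps) (cong suc len) (trans C≡ (cong (λ n → replicate n mark ++ top ∷ g₀) (+-suc (length ds) i))) V≡

  padding-run : ∀ j {rw i c g g₀} → c ∷ g ≡ replicate i mark ++ top ∷ g₀ →
    Run t q (config (sim rewindClock s) X (written (pushDigits (replicate j false) rw)) A Y (act (wall false , moveRight) V)
                    (at [ blank ] (replicate (j + i) mark ++ top ∷ g₀)) W) v →
    Run (suc (2 * j) + t) q (config (sim padding s) X (written rw) A Y V (clock j c g) W) v
  padding-run {t} {q} {s} {X} {A} {Y} {V} {W} {v} zero {rw} C≡ run =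
    one-step refl refl
      (subst (λ ss → Run t q (config (sim rewindClock s) X (written rw) A Y (act (wall false , moveRight) V) (at [ blank ] ss) W) v)
        (sym C≡) run)
  padding-run {t} {q} {s} {X} {A} {Y} {V} {W} {v} (suc j) {rw} {i} {g₀ = g₀} C≡ run =
    weaken (≤-reflexive (arith j t))
      (one-step refl refl (one-step refl refl (padding-run j {i = suc i} (cong (mark ∷_) C≡)
        (subst (λ n → Run t q (config (sim rewindClock s) X (written (pushDigits (replicate j false) (false ∷ false ∷ rw))) A Y
                                      (act (wall false , moveRight) V) (at [ blank ] (replicate n mark ++ top ∷ g₀)) W) v)
          (sym (+-suc j i)) run))))
    where
    arith : ∀ j t → suc (suc (suc (2 * j) + t)) ≡ suc (2 * suc j) + t
    arith = solve-∀

  rewindClock-run : ∀ j {i g₀} →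
    Run t q (config (sim simulate s) X Q A Y V (clock (j + i) mark g₀) W) v →
    Run (suc j + t) q (config (sim rewindClock s) X Q A Y V (at (replicate i mark ++ [ blank ]) (replicate j mark ++ top ∷ g₀)) W) v
  rewindClock-run zero run = one-step refl refl run
  rewindClock-run {t} {q} {s} {X} {Q} {A} {Y} {V} {W} {v} (suc j) {i} {g₀} run =
    one-step refl refl
      (subst (λ C → Run (suc j + t) q (config (sim rewindClock s) X Q A Y V C W) v)
        (sym (moveRight-at (replicate i mark ++ [ blank ]) mark (replicate j mark ++ top ∷ g₀)))
        (rewindClock-run j {suc i}
          (subst (λ n → Run t q (config (sim simulate s) X Q A Y V (clock n mark g₀) W) v) (sym (+-suc j i)) run)))

  leaf-time : ℕ → ℕ
  leaf-time m = suc (2 * m) + suc m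

  answered-run : ∀ {m} j {rw i c g g₀} → c ∷ g ≡ replicate i mark ++ top ∷ g₀ → j + i ≡ m →
    Run t q (config (sim simulate s) X (written (pushDigits (replicate j false) rw)) A Y (act (wall false , moveRight) V)
                    (clock m mark g₀) W) v →
    Run (leaf-time m + t) q (config (sim padding s) X (written rw) A Y V (clock j c g) W) v
  answered-run {t} {q} {s} {X} {A} {Y} {V} {W} {v} {m} j {rw} {i} {g₀ = g₀} C≡ refl run =
    weaken (≤-trans (+-monoˡ-≤ (suc (j + i) + t) (s≤s (*-monoʳ-≤ 2 (m≤m+n j i))))
                    (≤-reflexive (sym (+-assoc (suc (2 * (j + i))) (suc (j + i)) t))))
      (padding-run j C≡ (rewindClock-run (j + i)
        (subst (λ n → Run t q (config (sim simulate s) X (written (pushDigits (replicate j false) rw)) A Y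
                                      (act (wall false , moveRight) V) (clock n mark g₀) W) v)
          (sym (+-identityʳ (j + i))) run)))

  query-time : ℕ → ℕ → ℕ
  query-time n m = suc (2 * n) + (suc n + (suc (2 * m) + suc (leaf-time m)))

  -- `ds` is the guess shown to the simulated machine and `ds⁺` its padded form in the query word.
  -- `blankEnd` accounts for the blank that the copying head may have visited behind the query.
  query-run : ∀ u {zs l lv rw m c g} (h : List Bool → Value) →
    bitPrefix zs ≡ [] → left V ≡ wall false ∷ lv →
    (∀ {ds ds⁺ V} → binaryLSB (value ds) ≡ ds → length ds⁺ ≡ m → value ds⁺ ≡ value ds →
       Represents (just false) (just true) (writeWord (reverse ds)) V →
       Run t q (config (sim simulate s) X (written (pushAnswer u ds⁺ rw)) A (at l (map bit u ++ blankEnd zs)) V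
                       (clock m mark (c ∷ g)) W) (h ds)) →
    Run (query-time (length u) m + t) q
      (config (sim copy s) X (written (true ∷ rw)) A (at l (map bit u ++ zs)) V (clock (suc m) c g) W) (answers m h)
  query-run {t = t} {q} {s} {X} {A} {W} u {zs} {l} {lv} {rw} {m} {c} {g} h none V≡ k =
    weaken (≤-reflexive (trans (cong (λ n → suc (2 * length u) + (suc n + (suc (2 * m) + suc (leaf-time m + t)))) (length-reverse u))
                               (arith (suc (2 * length u)) (suc (length u)) (suc (2 * m)) (leaf-time m) t)))
      (copy-run u {i = 0} none V≡ λ {V} V≡ →
        subst₂ (λ lefts Y → Run (suc (length (reverse u)) + (suc (2 * m) + suc (leaf-time m + t))) q
                  (config (sim return s) X (written (pushBlock u rw)) A Y (move moveLeft (tape lefts (head V) (right V)))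
                          (clock (suc m) c g) W) (answers m h))
          (sym (trans V≡ (cong (λ n → walls n lv) (trans (+-identityʳ _) (sym (length-reverse u))))))
          (cong (λ l → at l zs) (sym (ʳ++-bits u)))
          (return-run (reverse u) zero-answer positive-answer))
    where
    arith : ∀ a b c d t → a + (b + (c + suc (d + t))) ≡ (a + (b + (c + suc d))) + t
    arith = solve-∀

    Y′ : Tape Aux
    Y′ = at l (map bit (reverse u) ʳ++ blankEnd zs)

    Y≡ : Y′ ≡ at l (map bit u ++ blankEnd zs)
    Y≡ = cong (at l) (bits-ʳ++ u)

    zero-answer : ∀ {V gv} → right V ≡ wall true ∷ gv →
      Run (suc (2 * m) + suc (leaf-time m + t)) q
        (config (sim answerZero s) X (written (pushBlock u rw)) A Y′ V (clock m top (c ∷ g)) W) (h [ false ])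
    zero-answer {V} V≡ rewrite Y≡ =
      weaken (m≤n+m (suc (leaf-time m + t)) (suc (2 * m)))
        (one-step refl refl (answered-run m {i = 0} refl (+-identityʳ m)
          -- The guess 0 records no digit of its own: its `m` digits are all padding.
          (k {ds = [ false ]} {ds⁺ = replicate m false} refl (length-replicate m) (value-padded [] m)
             (represents-word {w = [ false ]} {V = act (bit false , moveLeft) V} (s≤s z≤n)
               (trans (right-moveLeft (record V { head = bit false })) (cong (bit false ∷_) V≡))))))

    positive-answer : ∀ {V gv} → right V ≡ wall true ∷ gv →
      Run (suc (2 * m) + suc (leaf-time m + t)) q
        (config (sim answer s) X (written (pushBlock u rw)) A Y′ V (clock m top (c ∷ g)) W) (guesses m h)
    positive-answer V≡ rewrite Y≡ =
      answer-run m h {ds′ = []} {i = 0} refl V≡ λ {ds} {j} {V} ps len C≡ V≡ →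
        answered-run j C≡ (trans (cong (j +_) (+-identityʳ (length ds))) (trans (+-comm j (length ds)) len))
          (subst (λ rw → Run t q (config (sim simulate s) X (written rw) A (at l (map bit u ++ blankEnd zs)) _ (clock m mark (c ∷ g)) W) (h ds))
            (pushDigits-++ ds (replicate j false) (pushBlock u rw))
            (k {ds⁺ = ds ++ replicate j false} (binaryLSB-value ps)
               (trans (length-++ ds) (trans (cong (length ds +_) (length-replicate j)) len))
               (value-padded ds j)
               (represents-word {w = reverse ds} {V = V} (subst (1 ≤_) (sym (length-reverse ds)) (positive-length ps)) V≡)))

  rewindQuery-run : ∀ {b} rs {h r} →
    Run t q (config (verdict ask b) X (at [ blank ] (map bit rs ʳ++ (h ∷ r))) A Y V C W) v →
    Run (suc (length rs) + t) q (config (verdict rewindQuery b) X (move moveLeft (tape (map bit rs) h r)) A Y V C W) v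
  rewindQuery-run []       run = one-step refl refl run
  rewindQuery-run (r ∷ rs) run = one-step refl refl (rewindQuery-run rs run)

  check-run : ∀ b u {l} → Run (2 + length u) 0 (config (verdict check b) X Q (at l (map bit u)) Y V C W)
                              (if and u then weight b else ε)
  check-run b []          = one-step refl refl (done-run b)
  check-run b (false ∷ u) = one-step refl refl failed-run
  check-run {X} {Q} {Y} {V} {C} {W} b (true ∷ u) {l} =
    one-step refl refl
      (subst (λ A → Run (2 + length u) 0 (config (verdict check b) X Q A Y V C W) (if and u then weight b else ε))
        (sym (moveRight-at l top (map bit u))) (check-run b u))

  judged : Word → Bool → Value
  judged rw b = if and (binary (worth f (finished rw))) then weight b else ε

  verdict-time : Word → ℕ
  verdict-time rw = suc (suc (suc (length rw)) + suc (2 + length (binary (worth f (finished rw)))))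

  verdict-run : ∀ b rw →
    Run (verdict-time rw) 1 (config (verdict finish b) X (written (false ∷ rw)) A Y V C W) (judged rw b)
  verdict-run {X} {A} {Y} {V} {C} {W} b rw =
    one-step refl refl (rewindQuery-run (false ∷ rw)
      (subst (λ Q → Run (suc (2 + length (binary (worth f (finished rw))))) 1 (config (verdict ask b) X (at [ blank ] Q) A Y V C W) (judged rw b))
        (map-ʳ++ bit (false ∷ rw)) asked))
    where
    asked : Run (suc (2 + length (binary (worth f (finished rw))))) 1
                (config (verdict ask b) X (at [ blank ] (map bit (finished rw))) A Y V C W) (judged rw b)
    asked = run₁ {q = 0} (cong (λ A → [ config (verdict check b) X (at [ blank ] (map bit (finished rw))) A Y V C W ])
                       (trans (cong (writeWord ∘ binary ∘ worth f) (readWord-at [ blank ] (finished rw))) (at-writeWord (binary (worth f (finished rw))))))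
                 ≤-refl (check-run b (binary (worth f (finished rw))))

-- The simulation as a whole

module Simulating (𝒦 : Counting) (M : OracleMachine) (rounds : ℕ) (f : Word → ℕ)
  (halting digits size room response : ℕ)
  (small : ∀ y → length y ≤ suc halting → f y < 2 ^ digits)
  (short : ∀ w → length w ≤ 2 + room → length (binary (worth f w)) ≤ response)
  where

  open OneQuery 𝒦 M rounds
  open Correctness 𝒦 M rounds f
  open Queries 𝒦 M rounds f
  open Counting 𝒦
  open Guessing 𝒦
  open Ledger f
  open System system using (Config; step; querying)
  module RunsM = Runs 𝒦 (M withOracle f)
  open Runs 𝒦 system

  -- A bound on the bits that one call adds to the query word: `size` digits of two bits each, and
  -- the block of a query of at most `suc size` bits.
  growth : ℕ
  growth = 2 * size + suc (2 * suc size + 1)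

  -- The 3 pays for the transition that dispatches and for the two steps that may be spent on a wall
  -- before the next one.
  step-time : ℕ
  step-time = 3 + query-time (suc size) size

  end-time : ℕ
  end-time = suc (suc (suc (suc room) + suc (2 + response)))

  simulation-time : ℕ → ℕ
  simulation-time r = 2 + (r * step-time + end-time)

  -- While all answers have been correct, the simulated configuration yields
  -- what it does in M; after a wrong one, it must yield nothing.

  data Status (rw : Word) (r : ℕ) : M.Config → Value → Set where
    correct : ∀ {t q s X Y V W v} → Correct rw → RunsM.Run t q (s , X ∷ Y ∷ V ∷ W) v →
              length (right Y) + t ≤ halting → digits + t < r → Status rw r (s , X ∷ Y ∷ V ∷ W) v
    wrong   : ∀ {c} → Wrong rw → Status rw r c ε

  data Statuses (rw : Word) (r : ℕ) : List M.Config → Value → Set where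
    []  : Statuses rw r [] ε
    _∷_ : ∀ {c cs v w} → Status rw r c v → Statuses rw r cs w → Statuses rw r (c ∷ cs) (v ∙ w)

  -- A step lengthens the query tape by at most one cell and spends one mark, so its extent plus the
  -- clock reading never grows. Likewise `growth` bits of the query word are reserved per mark. Both
  -- bounds persist after wrong answers, where only the clock limits the simulation.
  Simulates : ℕ → Set
  Simulates r = ∀ {s X₀ Y₀ V₀ W₀ X A Y V W c g rw v} →
    Represents nothing nothing X₀ X → Represents nothing nothing Y₀ Y →
    Reaches (just false) (just true) V₀ V → AllRepresent W₀ W →
    length (right Y₀) + r ≤ size → length rw + r * growth ≤ room →
    Status rw r (s , X₀ ∷ Y₀ ∷ V₀ ∷ W₀) v →
    Run (simulation-time r) 1 (config (sim simulate s) X (written rw) A Y V (clock r c g) W) v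

  -- A correct branch always has more marks left than steps to go, so the clock runs out only after
  -- a wrong answer and abandoning the path loses nothing.
  expired : ∀ {rw c v} → Status rw 0 c v → v ≡ ε
  expired (correct _ _ _ ())
  expired (wrong _) = refl

  dispatch-step : ∀ {s X₀ Y₀ V₀ W₀ X A Y V C W Q m trs} →
    Represents nothing nothing X₀ X → Represents nothing nothing Y₀ Y →
    Represents (just false) (just true) V₀ V → AllRepresent W₀ W →
    M.resume s ≡ m → M.δ s (Vec.map head (X₀ ∷ Y₀ ∷ V₀ ∷ W₀)) ≡ trs →
    let ts = X ∷ Q ∷ A ∷ Y ∷ V ∷ C ∷ W in
    step (sim simulate s , ts) ≡ map (perform ts) (dispatch s m trs (Vec.map head ts))
  dispatch-step {X₀ = X₀} {Y₀} {X = X} {Y = Y} rX rY (rep {h = h} _ _) rW refl refl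
    rewrite sym (all-heads-represent rW) | sym (heads-represent rX) | sym (heads-represent rY) with h
  ... | blank = refl
  ... | bit _ = refl
  ... | aux _ = refl

  plain-step : ∀ {s ts} → M.resume s ≡ nothing →
               M.oracleStep f (s , ts) ≡ map (perform ts) (M.δ s (Vec.map head ts))
  plain-step eq rewrite eq = refl

  call-step : ∀ {s s′ X Y V W} → M.resume s ≡ just s′ →
              M.oracleStep f (s , X ∷ Y ∷ V ∷ W) ≡ [ s′ , X ∷ Y ∷ writeWord (binary (f (readWord Y))) ∷ W ]
  call-step eq rewrite eq = refl

  correct-statuses : ∀ {rw r t q trs X Y V W v} → Correct rw → suc (length (right Y)) + t ≤ halting → digits + t < r →
    RunsM.Runs t q (map (perform (X ∷ Y ∷ V ∷ W)) trs) v →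
    Statuses rw r (map (perform (X ∷ Y ∷ V ∷ W)) trs) v
  correct-statuses {trs = []}                        _ _ _ RunsM.[]            = []
  correct-statuses {trs = (_ , _ ∷ ay ∷ _ ∷ _) ∷ _} {Y = Y} ok fits time (run RunsM.∷ runs) =
    correct ok run (≤-trans (+-monoˡ-≤ _ (length-right-act ay Y)) fits) time ∷ correct-statuses ok fits time runs

  wrong-statuses : ∀ {rw r} → Wrong rw → ∀ cs → Statuses rw r cs ε
  wrong-statuses bad []       = []
  wrong-statuses bad (c ∷ cs) = subst (Statuses _ _ (c ∷ cs)) (identityˡ ε) (wrong bad ∷ wrong-statuses bad cs)

  moved-statuses : ∀ {rw r s X Y V W tr trs v} → M.resume s ≡ nothing →
    M.δ s (Vec.map head (X ∷ Y ∷ V ∷ W)) ≡ tr ∷ trs → Status rw (suc r) (s , X ∷ Y ∷ V ∷ W) v →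
    Statuses rw r (map (perform (X ∷ Y ∷ V ∷ W)) (tr ∷ trs)) v
  moved-statuses eqr eqδ (wrong bad) = wrong-statuses bad _
  moved-statuses {s = s} {X} {Y} {V} {W} eqr eqδ (correct ok (RunsM.halt eq _) fits time)
    with trans (sym eq) (trans (plain-step {s} {X ∷ Y ∷ V ∷ W} eqr) (cong (map (perform (X ∷ Y ∷ V ∷ W))) eqδ))
  ... | ()
  moved-statuses {r = r} {s} {X} {Y} {V} {W} {tr} {trs} {v} eqr eqδ (correct ok (RunsM.go {t} {q} eq _ runs) fits time) =
    correct-statuses {trs = tr ∷ trs} ok (subst (_≤ halting) (+-suc (length (right Y)) t) fits)
      (≤-pred (subst (_< suc r) (+-suc digits t) time))
      (subst (λ cs → RunsM.Runs t q cs v)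
        (trans (sym eq) (trans (plain-step {s} {X ∷ Y ∷ V ∷ W} eqr) (cong (map (perform (X ∷ Y ∷ V ∷ W))) eqδ))) runs)

  moves-run : ∀ {r} → Simulates r → ∀ trs {X₀ Y₀ V₀ W₀ X A Y V W c g rw v} →
    Represents nothing nothing X₀ X → Represents nothing nothing Y₀ Y →
    Represents (just false) (just true) V₀ V → AllRepresent W₀ W →
    suc (length (right Y₀)) + r ≤ size → length rw + r * growth ≤ room →
    Statuses rw r (map (perform (X₀ ∷ Y₀ ∷ V₀ ∷ W₀)) trs) v →
    let ts = X ∷ written rw ∷ A ∷ Y ∷ V ∷ clock (suc r) c g ∷ W in
    Runs (simulation-time r) 1 (map (perform ts) (map (simulated (Vec.map head ts)) trs)) v
  moves-run rec [] rX rY rV rW fits fits′ [] = []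
  moves-run rec ((s , (x , mx) ∷ (y , my) ∷ (v , mv) ∷ aws) ∷ trs) {Y₀ = Y₀} rX rY rV rW fits fits′ (status ∷ statuses) =
    rec (act-represents x mx rX) (act-represents y my rY) (act-reaches v mv rV) (act-all-represent aws rW)
        (≤-trans (+-monoˡ-≤ _ (length-right-act (y , my) Y₀)) fits) fits′ status
    ∷ moves-run rec trs rX rY rV rW fits fits′ statuses

  finished-value : ∀ {rw r s X Y V W v} → M.resume s ≡ nothing → M.δ s (Vec.map head (X ∷ Y ∷ V ∷ W)) ≡ [] →
    Status rw r (s , X ∷ Y ∷ V ∷ W) v → judged rw (M.accepting s) ≡ v
  finished-value {s = s} eqr eqδ (correct ok (RunsM.halt _ _) _ _) =
    cong (λ b → if b then weight (M.accepting s) else ε) (correct-finished ok)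
  finished-value {s = s} {X} {Y} {V} {W} eqr eqδ (correct ok (RunsM.go eq _ _) _ _)
    with trans (sym eq) (trans (plain-step {s} {X ∷ Y ∷ V ∷ W} eqr) (cong (map (perform (X ∷ Y ∷ V ∷ W))) eqδ))
  ... | ()
  finished-value {s = s} eqr eqδ (wrong bad) =
    cong (λ b → if b then weight (M.accepting s) else ε) (wrong-finished bad)

  -- The value obtained after the genuine call is assigned to the numeral of the true answer and `ε`
  -- to every other guess, so the sum over all guesses is the value in `M`. After an earlier error
  -- every guess gets `ε`.
  call-status : ∀ {rw m s s′ X Y V W v} → M.resume s ≡ just s′ → Status rw (suc m) (s , X ∷ Y ∷ V ∷ W) v →
    ∃[ h ] answers m h ≡ v ×
      (∀ {ds ds⁺} → binaryLSB (value ds) ≡ ds → length ds⁺ ≡ m → value ds⁺ ≡ value ds →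
         Status (pushAnswer (readWord Y) ds⁺ rw) m (s′ , X ∷ Y ∷ writeWord (reverse ds) ∷ W) (h ds))
  call-status {m = m} {Y = Y} eqr (wrong bad) = (λ _ → ε) , answers-ε m , λ {_} {ds⁺} _ _ _ → wrong (still-wrong (readWord Y) ds⁺ bad)
  call-status {s = s} {X = X} {Y} {V} {W} eqr (correct ok (RunsM.halt eq _) _ _)
    with trans (sym eq) (call-step {s} {X = X} {Y} {V} {W} eqr)
  ... | ()
  call-status {rw} {m} {s} {s′} {X} {Y} {V} {W} eqr (correct ok (RunsM.go {t} {q} eq _ runs) fits time)
    with trans (sym eq) (call-step {s} {X = X} {Y} {V} {W} eqr)
  call-status {rw} {m} {s} {s′} {X} {Y} {V} {W} eqr (correct ok (RunsM.go {t} {q} eq _ (RunsM._∷_ {v = v} run RunsM.[])) fits time)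
    | refl = h , trans (answers-pick {m} (≤-trans fu< (^-monoʳ-≤ 2 digits≤m)) other) (trans h-pick (sym (identityʳ v))) , λ {ds} {ds⁺} → status {ds} {ds⁺}
    where
    u = readWord Y
    target = binaryLSB (f u)

    h : List Bool → Value
    h ds = if does (≡-dec _≟ᵇ_ ds target) then v else ε

    h-pick : h target ≡ v
    h-pick rewrite dec-true (≡-dec _≟ᵇ_ target target) refl = refl

    other : ∀ {ds} → ds ≢ target → h ds ≡ ε
    other {ds} ≢target rewrite dec-false (≡-dec _≟ᵇ_ ds target) ≢target = refl

    time′ : digits + t < m
    time′ = ≤-pred (subst (_< suc m) (+-suc digits t) time)

    digits≤m : digits ≤ m
    digits≤m = ≤-trans (m≤m+n digits t) (<⇒≤ time′)

    fu< : f u < 2 ^ digits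
    fu< = small u (≤-trans (length-bitPrefix (head Y ∷ right Y)) (s≤s (≤-trans (m≤m+n _ (suc t)) fits)))

    status : ∀ {ds ds⁺} → binaryLSB (value ds) ≡ ds → length ds⁺ ≡ m → value ds⁺ ≡ value ds →
      Status (pushAnswer u ds⁺ rw) m (s′ , X ∷ Y ∷ writeWord (reverse ds) ∷ W) (h ds)
    status {ds} {ds⁺} canonical len val with ≡-dec _≟ᵇ_ ds target
    ... | yes refl = correct (correct-answer u ds⁺ (trans val (value-binaryLSB (f u))) ok) run
                       (≤-trans (+-monoʳ-≤ _ (n≤1+n t)) fits) time′
    -- Both numerals are canonical, so being different lists they have different values.
    ... | no ≢target = wrong (wrong-answer u ds⁺
            (λ eq → ≢target (trans (sym canonical) (cong binaryLSB (trans (sym val) eq))))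
            (subst (λ n → f u < 2 ^ n) (sym len) (≤-trans fu< (^-monoʳ-≤ 2 digits≤m))) ok)

  query-time-mono : ∀ {n n′ m m′} → n ≤ n′ → m ≤ m′ → query-time n m ≤ query-time n′ m′
  query-time-mono n≤ m≤ = +-mono-≤ (s≤s (*-monoʳ-≤ 2 n≤)) (+-mono-≤ (s≤s n≤)
    (+-mono-≤ (s≤s (*-monoʳ-≤ 2 m≤)) (s≤s (+-mono-≤ (s≤s (*-monoʳ-≤ 2 m≤)) (s≤s m≤)))))

  pushAnswer-fits : ∀ {m} u ds rw → length u ≤ suc size → length ds ≡ m → m ≤ size →
    length rw + suc m * growth ≤ room → length (pushAnswer u ds rw) + m * growth ≤ room
  pushAnswer-fits {m} u ds rw u≤ refl m≤ fits = ≤-trans (begin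
    length (pushDigits ds (pushBlock u rw)) + m * growth        ≡⟨ cong (_+ m * growth) (length-pushDigits ds (pushBlock u rw)) ⟩
    2 * m + suc (length (pushBits u (true ∷ rw))) + m * growth  ≡⟨ cong (λ n → 2 * m + suc n + m * growth) (length-pushBits u (true ∷ rw)) ⟩
    2 * m + suc (2 * length u + suc (length rw)) + m * growth   ≡⟨ arith m (length u) (length rw) (m * growth) ⟩
    length rw + ((2 * m + suc (2 * length u + 1)) + m * growth) ≤⟨ +-monoʳ-≤ (length rw) (+-monoˡ-≤ (m * growth)
                                                                    (+-mono-≤ (*-monoʳ-≤ 2 m≤) (s≤s (+-monoˡ-≤ 1 (*-monoʳ-≤ 2 u≤))))) ⟩
    length rw + suc m * growth                                  ∎) fits
    where
    open ≤-Reasoning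
    arith : ∀ m n l p → 2 * m + suc (2 * n + suc l) + p ≡ l + ((2 * m + suc (2 * n + 1)) + p)
    arith = solve-∀

  -- The clock reading `r` is the measure of the induction, since after a wrong answer `M` provides
  -- none. `M.resume s` and the transitions come with equations so that the clauses can split on
  -- them.
  simulate-run : ∀ r {s X₀ Y₀ V₀ W₀ X A Y V W c g rw v} → (∀ {m} → r ≡ suc m → Simulates m) →
    Represents nothing nothing X₀ X → Represents nothing nothing Y₀ Y →
    Represents (just false) (just true) V₀ V → AllRepresent W₀ W →
    length (right Y₀) + r ≤ size → length rw + r * growth ≤ room →
    Status rw r (s , X₀ ∷ Y₀ ∷ V₀ ∷ W₀) v →
    ∀ resumed → M.resume s ≡ resumed → ∀ trs → M.δ s (Vec.map head (X₀ ∷ Y₀ ∷ V₀ ∷ W₀)) ≡ trs →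
    Run (r * step-time + end-time) 1 (config (sim simulate s) X (written rw) A Y V (clock r c g) W) v
  simulate-run zero rec rX rY rV rW _ _ status (just s′) eqr trs eqδ =
    subst (Run _ 1 _) (sym (expired status)) (one-step (dispatch-step rX rY rV rW eqr eqδ) refl failed-run)
  simulate-run zero rec rX rY rV rW _ _ status nothing eqr trs@(_ ∷ _) eqδ =
    subst (Run _ 1 _) (sym (expired status)) (one-step (dispatch-step rX rY rV rW eqr eqδ) refl failed-run)
  -- Halting spends no mark, so this clause covers an exhausted clock as well.
  simulate-run r {rw = rw} rec rX rY rV rW _ fits′ status nothing eqr [] eqδ =
    subst (Run _ 1 _) (finished-value eqr eqδ status)
      (weaken (≤-trans (s≤s (s≤s (+-mono-≤ (s≤s (s≤s rw≤)) (s≤s (+-monoʳ-≤ 2 (short (finished rw) finished≤))))))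
                       (m≤n+m end-time (r * step-time)))
        (one-step (dispatch-step rX rY rV rW eqr eqδ) refl (verdict-run _ rw)))
    where
    rw≤ : length rw ≤ room
    rw≤ = ≤-trans (m≤m+n _ _) fits′
    finished≤ : length (finished rw) ≤ 2 + room
    finished≤ = ≤-trans (≤-reflexive (trans (length-ʳ++ rw) (+-comm (length rw) 2))) (+-monoʳ-≤ 2 rw≤)
  simulate-run (suc r) {Y₀ = Y₀} {rw = rw} rec rX rY rV rW fits fits′ status nothing eqr trs@(_ ∷ _) eqδ =
    weaken (≤-trans (s≤s (s≤s (s≤s (m≤n+m (r * step-time + end-time) (query-time (suc size) size)))))
                    (≤-reflexive (sym (+-assoc step-time (r * step-time) end-time))))
      (go (dispatch-step rX rY rV rW eqr eqδ) ≤-refl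
        (moves-run (rec refl) trs rX rY rV rW (subst (_≤ size) (+-suc (length (right Y₀)) r) fits)
          (≤-trans (+-monoʳ-≤ (length rw) (m≤n+m (r * growth) growth)) fits′) (moved-statuses eqr eqδ status)))
  simulate-run (suc m) {s} {Y₀ = Y₀} {W₀ = W₀} {X} {A} {V = V} {W} {c} {g} {rw} {v} rec rX rY@(rep {l′ = l} {r′ = r′} sl sr) rV rW fits fits′ status (just s′) eqr trs eqδ
    with call-status eqr status
  ... | h , answers≡ , statuses =
    subst (Run _ 1 _) answers≡
      (weaken time≤ (one-step (dispatch-step rX rY rV rW eqr eqδ) refl copying))
    where
    u = readWord Y₀

    cells : List (Symbol Aux)
    cells = embed (head Y₀) ∷ r′

    zs : List (Symbol Aux)
    zs = proj₁ (bitPrefix-split cells)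

    cells≡ : cells ≡ map bit u ++ zs
    cells≡ = trans (proj₁ (proj₂ (bitPrefix-split cells)))
                   (cong (λ u → map bit u ++ zs) (readWord-represents rY))

    fits-m : length (right Y₀) + m ≤ size
    fits-m = ≤-trans (+-monoʳ-≤ (length (right Y₀)) (n≤1+n m)) fits

    u≤ : length u ≤ suc size
    u≤ = ≤-trans (length-bitPrefix (head Y₀ ∷ right Y₀)) (s≤s (≤-trans (m≤m+n _ (suc m)) fits))

    m≤ : m ≤ size
    m≤ = ≤-trans (m≤n+m m _) fits-m

    time≤ : suc (query-time (length u) m + simulation-time m) ≤ suc m * step-time + end-time
    time≤ = begin
      suc (query-time (length u) m + (2 + rest))   ≤⟨ s≤s (+-monoˡ-≤ (2 + rest) (query-time-mono u≤ m≤)) ⟩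
      suc (query-time (suc size) size + (2 + rest)) ≡⟨ arith (query-time (suc size) size) rest ⟩
      step-time + rest                              ≡⟨ +-assoc step-time (m * step-time) end-time ⟨
      suc m * step-time + end-time                  ∎
      where
      open ≤-Reasoning
      rest = m * step-time + end-time
      arith : ∀ a b → suc (a + (2 + b)) ≡ (3 + a) + b
      arith = solve-∀

    copying : Run (query-time (length u) m + simulation-time m) 1
      (config (sim copy s′) X (written (true ∷ rw)) A (at l cells) (act (wall false , moveRight) V) (clock (suc m) c g) W)
      (answers m h)
    copying = subst (λ ss → Run (query-time (length u) m + simulation-time m) 1
        (config (sim copy s′) X (written (true ∷ rw)) A (at l ss) (act (wall false , moveRight) V) (clock (suc m) c g) W)
        (answers m h)) (sym cells≡)
      (query-run u h (proj₂ (proj₂ (bitPrefix-split cells))) (left-moveRight (record V { head = wall false }))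
        λ {ds} {ds⁺} canonical len val rV →
          rec refl rX (represents-at sl (side-blankEnd u zs cells≡ (head Y₀ ∷ sr))) (inside rV) rW fits-m
            (pushAnswer-fits u ds⁺ rw u≤ len m≤ fits′) (statuses {ds⁺ = ds⁺} canonical len val))

  simulates : ∀ r → Simulates r
  simulates r rX rY rV rW fits fits′ status =
    mend-run rV λ rV → simulate-run r rec rX rY rV rW fits fits′ status _ refl _ refl
    where
    rec : ∀ {m} → r ≡ suc m → Simulates m
    rec {m} refl = simulates m

-- The equalities of classes

module _ {f g : Word → ℕ} (f≗g : ∀ y → f y ≡ g y) where
  mutual
    -- Membership in #P gives `f` only pointwise as the count of a machine, so `worth` has to be
    -- shown to respect pointwise equality.
    worth-cong : ∀ w → worth f w ≡ worth g w
    worth-cong []              = refl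
    worth-cong (false ∷ [])    = refl
    worth-cong (false ∷ b ∷ w) = cong (λ n → n + (n + bitValue (not b))) (worth-cong w)
    worth-cong (true ∷ w)      = cong₂ _+_ (worthSkip-cong w) (worthLoad-cong [] w)

    worthSkip-cong : ∀ w → worthSkip f w ≡ worthSkip g w
    worthSkip-cong []             = refl
    worthSkip-cong (false ∷ w)    = worth-cong w
    worthSkip-cong (true ∷ [])    = refl
    worthSkip-cong (true ∷ _ ∷ w) = worthSkip-cong w

    worthLoad-cong : ∀ r w → worthLoad f r w ≡ worthLoad g r w
    worthLoad-cong r []             = refl
    worthLoad-cong r (false ∷ w)    = f≗g (reverse r)
    worthLoad-cong r (true ∷ [])    = refl
    worthLoad-cong r (true ∷ b ∷ w) = worthLoad-cong (b ∷ r) w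

#P-respects : ∀ {f g} → (∀ x → f x ≡ g x) → #P g → #P f
#P-respects f≗g (k , M , T , g≗) = k , M , T , λ x → trans (f≗g x) (g≗ x)

#P-worth : ∀ {f} → #P f → #P (worth f)
#P-worth (k , M , T , f≗) = #P-respects (worth-cong f≗) (Worth.worth-∈-#P M T)

-- The exponent is a successor, so that even the numeral of 0, which has one digit, is no longer
-- than the exponent.
record Size (f : Word → ℕ) : Set where
  field
    size  : ℕ → ℕ
    poly  : IsPoly size
    value< : ∀ {n} y → length y ≤ n → f y < 2 ^ suc (size n)

#P-size : ∀ {f} → #P f → Size f
#P-size {f} (_ , M , T , f≗) = bounded (acc-bound M T)
  where
  open PolynomialTime T using (acc; bound)
  bounded : ∃[ b ] (∀ x → acc x ≤ 2 ^ (b * bound (length x))) → Size f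
  bounded (b , acc≤) = record
    { size   = λ n → b * bound n
    ; poly   = poly-* (poly-const b) (poly-bound T)
    ; value< = λ {n} y y≤ → subst (_< 2 ^ suc (b * bound n)) (sym (f≗ y))
        (≤-<-trans (≤-trans (acc≤ y) (^-monoʳ-≤ 2 (*-monoʳ-≤ b (bound-mono T y≤))))
                   (^-monoʳ-< 2 (s≤s (s≤s z≤n)) (n<1+n (b * bound n))))
    }

OneQueryVersion : (𝒦 : Counting) (M : OracleMachine) {f : Word → ℕ} → PolynomialTime (M withOracle f) → Set₁
OneQueryVersion 𝒦 M {f} T = Σ[ M′ ∈ OracleMachine ] Σ[ T′ ∈ PolynomialTime (M′ withOracle worth f) ]
  PolynomialTime.AtMostOneQuery T′ × (∀ x → value-of T′ x ≡ value-of T x)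
  where
  value-of : ∀ {S} → PolynomialTime S → Word → Counting.Value 𝒦
  value-of {S} T x = Counting.tally 𝒦 S (PolynomialTime.bound T (length x)) (System.initial S x)

-- Choice of the polynomial bounds

module Conversion (𝒦 : Counting) (M : OracleMachine) (f : Word → ℕ)
  (T : PolynomialTime (M withOracle f)) (F : Size f) (G : Size (worth f)) where

  open Counting 𝒦
  open PolynomialTime T using (bound)
  module F = Size F
  module G = Size G

  -- In `bound n` steps at most `bound n` cells come to lie right of the head of the query tape;
  -- with the scanned cell, a query has at most `suc (bound n)` bits.
  digits : ℕ → ℕ
  digits n = suc (F.size (suc (bound n)))

  module WithRounds (rounds : ℕ) (enough : ∀ n → suc (digits n + bound n) ≤ (2 + n) ^ rounds) where

    open OneQuery 𝒦 M rounds
    open Correctness 𝒦 M rounds f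
    module RunsM = Runs 𝒦 (M withOracle f)
    open Runs 𝒦 system

    marks-≥ : ∀ n k d → (2 + n) ^ k * d ≤ marks n k d
    marks-≥ n zero    d = ≤-reflexive (*-identityˡ d)
    marks-≥ n (suc k) d = begin
      (2 + n) ^ suc k * d       ≡⟨ arith (2 + n) ((2 + n) ^ k) d ⟩
      (2 + n) ^ k * (d * (2 + n)) ≤⟨ *-monoʳ-≤ ((2 + n) ^ k) (*-monoʳ-≤ d (s≤s (m≤n+m (suc n) n))) ⟩
      (2 + n) ^ k * (d * sweep n) ≤⟨ marks-≥ n k (d * sweep n) ⟩
      marks n (suc k) d         ∎
      where
      open ≤-Reasoning
      arith : ∀ a b d → a * b * d ≡ b * (d * a)
      arith = solve-∀

    initial-marks-> : ∀ n → digits n + bound n < initial-marks n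
    initial-marks-> n = begin
      suc (digits n + bound n)   ≤⟨ enough n ⟩
      (2 + n) ^ rounds           ≤⟨ m≤m*n _ (sweep n) ⟩
      (2 + n) ^ rounds * sweep n ≤⟨ marks-≥ n rounds (sweep n) ⟩
      initial-marks n            ∎
      where open ≤-Reasoning

    poly-sweep : IsPoly sweep
    poly-sweep = poly-+ (poly-+ (poly-const 1) poly-id) (poly-+ (poly-const 1) poly-id)

    poly-marks : ∀ k {d} → IsPoly d → IsPoly (λ n → marks n k (d n))
    poly-marks zero    d = d
    poly-marks (suc k) d = poly-marks k (poly-* d poly-sweep)

    poly-suc : ∀ {h} → IsPoly h → IsPoly (λ n → suc (h n))
    poly-suc = poly-+ (poly-const 1)

    poly-rounds-time : ∀ k {d} → IsPoly d → IsPoly (λ n → rounds-time n k (d n))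
    poly-rounds-time zero    d = poly-suc d
    poly-rounds-time (suc k) d = poly-+ (poly-suc d) (poly-+ (poly-* d (poly-suc poly-sweep))
      (poly-suc (poly-rounds-time k (poly-* d poly-sweep))))

    growth : ℕ → ℕ
    growth n = 2 * initial-marks n + suc (2 * suc (initial-marks n) + 1)

    -- Every call spends a mark, and adds at most `growth n` bits.
    room : ℕ → ℕ
    room n = initial-marks n * growth n

    -- The final check reads the whole answer. It stays polynomially long because `worth f` is
    -- itself in #P.
    response : ℕ → ℕ
    response n = suc (G.size (2 + room n))

    module _ (n : ℕ) where
      open Simulating 𝒦 M rounds f (bound n) (digits n) (initial-marks n) (room n) (response n)
        (λ y y≤ → F.value< y y≤)
        (λ w w≤ → ≤-trans (≤-reflexive (length-reverse (binaryLSB (worth f w)))) (length-binaryLSB (G.value< w w≤)))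
        public using (simulates; correct; simulation-time)

    total-time : ℕ → ℕ
    total-time n = build-time n + simulation-time n (initial-marks n)

    value-of : Word → Value
    value-of x = tally (M withOracle f) (bound (length x)) (System.initial (M withOracle f) x)

    initial-run : ∀ x → Run (total-time (length x)) 1 (System.initial system x) (value-of x)
    initial-run x = build-run x
      (simulates n (initial-marks n) (swept-represents x) empty-represents (inside empty-represents)
        (empty-all-represent _) ≤-refl ≤-refl
        (correct (Ledger.correct-[] f) (RunsM.halts-run (bound n) (PolynomialTime.halts T x)) ≤-refl (initial-marks-> n)))
      where n = length x

    abstract
      poly-total-time : IsPoly total-time
      poly-total-time =
        poly-+ (poly-+ poly-sweep (poly-suc (poly-rounds-time rounds poly-sweep)))
          (poly-+ (poly-const 2) (poly-+ (poly-* poly-R poly-step)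
            (poly-suc (poly-suc (poly-+ (poly-suc (poly-suc poly-room)) (poly-suc (poly-+ (poly-const 2) poly-response)))))))
        where
        poly-R : IsPoly initial-marks
        poly-R = poly-marks rounds poly-sweep
        twice : ∀ {h} → IsPoly h → IsPoly (λ n → suc (2 * h n))
        twice h = poly-suc (poly-* (poly-const 2) h)
        poly-step : IsPoly (λ n → 3 + Queries.query-time 𝒦 M rounds f (suc (initial-marks n)) (initial-marks n))
        poly-step = poly-+ (poly-const 3) (poly-+ (twice (poly-suc poly-R)) (poly-+ (poly-suc (poly-suc poly-R))
          (poly-+ (twice poly-R) (poly-suc (poly-+ (twice poly-R) (poly-suc poly-R))))))
        poly-room : IsPoly room
        poly-room = poly-* poly-R (poly-+ (poly-* (poly-const 2) poly-R)
          (poly-suc (poly-+ (poly-* (poly-const 2) (poly-suc poly-R)) (poly-const 1))))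
        poly-response : IsPoly response
        poly-response = poly-suc (poly-∘ G.poly (poly-+ (poly-const 2) poly-room))

    time-bound = poly⇒monomial poly-total-time

    run-within : ∀ x → Run (proj₁ time-bound * length x ^ proj₁ (proj₂ time-bound) + proj₁ time-bound) 1
                           (System.initial system x) (value-of x)
    run-within x = weaken (proj₂ (proj₂ time-bound) (length x)) (initial-run x)

    polynomialTime : PolynomialTime (machine withOracle worth f)
    polynomialTime = record
      { coefficient = proj₁ time-bound
      ; degree      = proj₁ (proj₂ time-bound)
      ; halts       = λ x → run-halts (run-within x)
      }

  abstract
    poly-demand : IsPoly (λ n → suc (digits n + bound n))
    poly-demand = poly-+ (poly-const 1) (poly-+ (poly-+ (poly-const 1)
      (poly-∘ F.poly (poly-+ (poly-const 1) (poly-bound T)))) (poly-bound T))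

  converted : OneQueryVersion 𝒦 M T
  converted = machine , polynomialTime , (λ x → run-queries (run-within x)) , (λ x → run-tally (run-within x))
    where
    -- A sweep has length at least `2 + n`, so the exponent witnessing `IsPoly` can directly serve
    -- as the number of rounds.
    open WithRounds (proj₁ poly-demand) (proj₂ poly-demand)
    open OneQuery 𝒦 M (proj₁ poly-demand)
    open Correctness 𝒦 M (proj₁ poly-demand) f
    open Runs 𝒦 system

convert : ∀ 𝒦 M {f} → #P f → (T : PolynomialTime (M withOracle f)) → OneQueryVersion 𝒦 M T
convert 𝒦 M {f} f∈#P T = Conversion.converted 𝒦 M f T (#P-size f∈#P) (#P-size (#P-worth f∈#P))

-- Counting gaps, and the theorem

gapCount : Counting
gapCount = record
  { Value = ℤ ; _∙_ = ℤ._+_ ; ε = 0ℤ ; isMonoid = ℤ.+-0-isMonoid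
  ; weight = λ b → if b then 1ℤ else -1ℤ
  ; void = true ∷ false ∷ [] ; void-nonempty = refl ; void-total = refl
  }

gap-total : ∀ {A : Set} (p : A → Bool) xs →
  length (filterᵇ p xs) ⊖ length (filterᵇ (not ∘ p) xs) ≡ Counting.total gapCount (map (Counting.weight gapCount ∘ p) xs)
gap-total p []       = refl
gap-total p (x ∷ xs) with p x
... | true  = trans (cong (_⊖ rejected) (+-comm 1 accepted))
                (trans (sym (ℤ.distribˡ-⊖-+-pos 1 accepted rejected))
                  (trans (ℤ.+-comm (accepted ⊖ rejected) 1ℤ) (cong (ℤ._+_ 1ℤ) (gap-total p xs))))
  where
  accepted = length (filterᵇ p xs)
  rejected = length (filterᵇ (not ∘ p) xs)
... | false = trans (cong (accepted ⊖_) (sym (+-identityʳ (suc rejected))))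
                (trans (sym (ℤ.distribˡ-⊖-+-neg 0 accepted rejected))
                  (trans (ℤ.+-comm (accepted ⊖ rejected) -1ℤ) (cong (ℤ._+_ -1ℤ) (gap-total p xs))))
  where
  accepted = length (filterᵇ p xs)
  rejected = length (filterᵇ (not ∘ p) xs)

gap-tally : ∀ {S : System} (T : PolynomialTime S) x → PolynomialTime.gap T x ≡
            Counting.tally gapCount S (PolynomialTime.bound T (length x)) (System.initial S x)
gap-tally {S} T x = gap-total (accepts S) (PolynomialTime.computationPaths T x)

#P^#P⊆#P^#P[1] : ∀ {g} → #P^#P g → #P^#P[1] g
#P^#P⊆#P^#P[1] {g} (f , f∈#P , M , T , g≗) = from (convert acceptanceCount M f∈#P T)
  where
  from : OneQueryVersion acceptanceCount M T → #P^#P[1] g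
  from (M′ , T′ , one-query , same) = worth f , #P-worth f∈#P , M′ , T′ , one-query ,
    λ x → trans (g≗ x) (trans (acc-tally T x) (trans (sym (same x)) (sym (acc-tally T′ x))))

GapP^#P⊆GapP^#P[1] : ∀ {g} → GapP^#P g → GapP^#P[1] g
GapP^#P⊆GapP^#P[1] {g} (f , f∈#P , M , T , g≗) = from (convert gapCount M f∈#P T)
  where
  from : OneQueryVersion gapCount M T → GapP^#P[1] g
  from (M′ , T′ , one-query , same) = worth f , #P-worth f∈#P , M′ , T′ , one-query ,
    λ x → trans (g≗ x) (trans (gap-tally T x) (trans (sym (same x)) (sym (gap-tally T′ x))))

proposition6p3 : (#P^#P ≐ #P^#P[1]) × (GapP^#P ≐ GapP^#P[1])
proposition6p3 =
  (#P^#P⊆#P^#P[1] , λ (f , f∈#P , M , T , _ , g≗) → f , f∈#P , M , T , g≗) ,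
  (GapP^#P⊆GapP^#P[1] , λ (f , f∈#P , M , T , _ , g≗) → f , f∈#P , M , T , g≗)
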